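{- For every tree $T$ with at least $3$ vertices, $\mathrm{sd}_{\gamma_t}(T)=\mathrm{msd}_{\gamma_t}(T)$.
   Context: A set $S\subseteq V(G)$ is a total dominating set of $G$ if every vertex of $G$ is adjacent to a vertex of $S$; $\gamma_t(G)$ is the minimum size of such a set. The total domination subdivision number $\mathrm{sd}_{\gamma_t}(G)$ is the minimum number of edges that must be subdivided (each edge subdivided at most once, i.e. replaced by a path of length 2 through a new vertex) in order to increase $\gamma_t$. For an edge $e=uv$ and integer $t\ge1$, $G_{e,t}$ denotes the graph obtained from $G$ by replacing $uv$ by a path $(u,x_1,\dots,x_t,v)$ with $t$ new vertices; $\mathrm{msd}_{\gamma_t}(uv)$ is the minimum positive integer $t$ with $\gamma_t(G_{uv,t})>\gamma_t(G)$, and $\mathrm{msd}_{\gamma_t}(G)=\min\{\mathrm{msd}_{\gamma_t}(uv): uv\in E(G)\}$. -}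

module Defs where

open import Data.Nat using (ℕ; zero; suc; _≤_; _<_)
open import Data.Bool using (Bool; true)
open import Data.Fin using (Fin; toℕ)
open import Data.List using (List; []; _∷_; _++_; [_]; length; lookup)
open import Data.List.Membership.Propositional using (_∈_)
open import Data.List.Relation.Unary.Any using (Any)
open import Data.List.Relation.Unary.AllPairs using (AllPairs)
open import Data.List.Relation.Unary.Linked using (Linked)
open import Data.List.Relation.Unary.Unique.Propositional using (Unique)
open import Data.Product using (Σ; _×_; _,_; proj₁; proj₂; ∃)
open import Data.Sum using (_⊎_; inj₁; inj₂)
open import Data.Empty using (⊥)
open import Relation.Nullary using (¬_)
open import Relation.Binary.PropositionalEquality using (_≡_)

record Graph : Set₁ where
  field
    V   : Set
    Adj : V → V → Set
open Graph public

fromMatrix : (n : ℕ) → (Fin n → Fin n → Bool) → Graph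
fromMatrix n A = record { V = Fin n ; Adj = λ u v → A u v ≡ true }

IsSimpleMatrix : (n : ℕ) → (Fin n → Fin n → Bool) → Set
IsSimpleMatrix n A = (∀ u v → A u v ≡ A v u) × (∀ u → ¬ (A u u ≡ true))

data Walk (G : Graph) : V G → V G → Set where
  here : ∀ {u} → Walk G u u
  step : ∀ {u w v} → Adj G u w → Walk G w v → Walk G u v

Connected : Graph → Set
Connected G = ∀ u v → Walk G u v

IsCycle : (G : Graph) → V G → List (V G) → Set
IsCycle G x xs = (2 ≤ length xs) × Unique (x ∷ xs) × Linked (Adj G) (x ∷ xs ++ [ x ])

Acyclic : Graph → Set
Acyclic G = ∀ x xs → ¬ IsCycle G x xs

IsTree : Graph → Set
IsTree G = Connected G × Acyclic G

-- Total domination.  Vertex sets are duplicate-free lists; size = length.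

IsTDS : (G : Graph) → List (V G) → Set
IsTDS G S = Unique S × (∀ v → ∃ λ u → u ∈ S × Adj G v u)

IsγtValue : Graph → ℕ → Set
IsγtValue G k =
  (Σ (List (V G)) λ S → IsTDS G S × length S ≡ k) ×
  (∀ S → IsTDS G S → k ≤ length S)

γtIncreases : Graph → Graph → Set
γtIncreases G G' = Σ ℕ λ k → Σ ℕ λ k' → IsγtValue G k × IsγtValue G' k' × k < k'

SameEdge : {A : Set} → A × A → A × A → Set
SameEdge (a , b) (c , d) = (a ≡ c × b ≡ d) ⊎ (a ≡ d × b ≡ c)

IsEdgeSet : (G : Graph) → List (V G × V G) → Set
IsEdgeSet G F =
  Data.List.Relation.Unary.All.All (λ e → Adj G (proj₁ e) (proj₂ e)) F ×
  AllPairs (λ e f → ¬ SameEdge e f) F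
  where import Data.List.Relation.Unary.All

-- New vertex inj₂ i is placed on edge number i of F.
subdivide : (G : Graph) → List (V G × V G) → Graph
subdivide G F = record { V = V G ⊎ Fin (length F) ; Adj = adj }
  where
  ends : V G → Fin (length F) → Set
  ends a i = a ≡ proj₁ (lookup F i) ⊎ a ≡ proj₂ (lookup F i)
  adj : V G ⊎ Fin (length F) → V G ⊎ Fin (length F) → Set
  adj (inj₁ a) (inj₁ b) = Adj G a b × ¬ Any (SameEdge (a , b)) F
  adj (inj₁ a) (inj₂ i) = ends a i
  adj (inj₂ i) (inj₁ a) = ends a i
  adj (inj₂ i) (inj₂ j) = ⊥

IsSdγt : Graph → ℕ → Set
IsSdγt G k =
  (Σ (List (V G × V G)) λ F → IsEdgeSet G F × length F ≡ k × γtIncreases G (subdivide G F)) ×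
  (∀ F → IsEdgeSet G F → γtIncreases G (subdivide G F) → k ≤ length F)

-- G_{uv,t}: replace edge uv by the path u, x₀, …, x_{t-1}, v.

subdivideEdge : (G : Graph) → V G → V G → ℕ → Graph
subdivideEdge G u v t = record { V = V G ⊎ Fin t ; Adj = adj }
  where
  att : V G → Fin t → Set
  att a i = (a ≡ u × toℕ i ≡ 0) ⊎ (a ≡ v × suc (toℕ i) ≡ t)
  adj : V G ⊎ Fin t → V G ⊎ Fin t → Set
  adj (inj₁ a) (inj₁ b) = Adj G a b × ¬ SameEdge (a , b) (u , v)
  adj (inj₁ a) (inj₂ i) = att a i
  adj (inj₂ i) (inj₁ a) = att a i
  adj (inj₂ i) (inj₂ j) = (suc (toℕ i) ≡ toℕ j) ⊎ (suc (toℕ j) ≡ toℕ i)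

IsMsdγtEdge : (G : Graph) → V G → V G → ℕ → Set
IsMsdγtEdge G u v t =
  (1 ≤ t × γtIncreases G (subdivideEdge G u v t)) ×
  (∀ s → 1 ≤ s → γtIncreases G (subdivideEdge G u v s) → t ≤ s)

IsMsdγt : Graph → ℕ → Set
IsMsdγt G k =
  (Σ (V G) λ u → Σ (V G) λ v → Adj G u v × IsMsdγtEdge G u v k) ×
  (∀ u v t → Adj G u v → IsMsdγtEdge G u v t → k ≤ t)

{-# OPTIONS --safe #-}
module Submission where

-- On a tree, γt equals the maximum size of an open packing: a vertex set in which no two members
-- have a common neighbour.  Fix a maximum open packing P.
-- If some vertex v has no neighbour in P, then P gains a vertex when an edge at v is subdivided
-- twice, or subdivided together with one further edge.  The same gains are possible when every
-- vertex has a neighbour in P but some leaf is missing from P.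
-- Otherwise P is perfect: P is a union of adjacent pairs, every vertex has exactly one neighbour
-- in P, and P contains all leaves.  Then two new vertices are never enough: moving every pair
-- that does not lie between the new vertices one step towards them yields a total dominating set
-- of size |P|.  Three new vertices do suffice, either on an edge inside P or on an edge aa′
-- outside P and the edges joining a and a′ to P.
-- Hence both numbers are 1, 2 or 3 under the same conditions.

open import Defs
open import Data.Bool using (Bool; true)
open import Data.Nat using (ℕ; zero; suc; _≤_; _<_; _+_; z≤n; s≤s)
open import Data.Nat.Properties using (≤-refl; ≤-reflexive; ≤-trans; ≤-antisym; ≤-decTotalOrder; <-trans; <-≤-trans; <-irrefl; <-cmp; <⇒≤; <⇒≱; suc-injective; m≤n⇒m≤1+n; m≤n⇒m<n∨m≡n; m≤m+n; +-suc; +-identityʳ; +-monoʳ-<)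
open import Data.Nat.Induction using (<-wellFounded)
open import Induction.WellFounded using (Acc; acc)
open import Data.Fin using (Fin; zero; suc; toℕ; fromℕ; inject₁)
open import Data.Fin.Properties using (toℕ-fromℕ; toℕ-inject₁)
open import Data.List using (List; []; _∷_; _++_; [_]; length; map; lookup; allFin; deduplicate)
open import Data.List.Properties using (length-map; length-deduplicate; length-tabulate)
open import Data.List.Membership.Propositional using (_∈_; _∉_; find; lose)
open import Data.List.Membership.Propositional.Properties using (∈-allFin; ∈-deduplicate⁺; ∈-lookup; ∈-map⁺; ∈-map⁻; ∈-++⁺ˡ; ∈-++⁺ʳ; ∈-++⁻)
open import Data.List.Relation.Unary.Any using (Any; here; there; any?; index)
open import Data.List.Relation.Unary.All using (All; []; _∷_; all?)
open import Data.List.Relation.Unary.AllPairs using (AllPairs; []; _∷_)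
open import Data.List.Relation.Unary.Linked using (Linked; [-]; _∷_)
open import Data.List.Relation.Unary.Unique.Propositional using (Unique)
open import Data.List.Relation.Binary.Permutation.Propositional using (↭-sym)
open import Data.List.Relation.Binary.Permutation.Propositional.Properties using (∈-resp-↭)
open import Data.Product using (Σ; ∃; _×_; _,_; proj₁; proj₂)
open import Data.Sum using (_⊎_; inj₁; inj₂; [_,_]′; swap)
open import Data.Sum.Properties using (inj₁-injective)
open import Data.Empty using (⊥; ⊥-elim)
open import Data.Unit using (⊤; tt)
open import Function using (_∘_)
open import Relation.Nullary using (¬_; Dec; yes; no)
open import Relation.Nullary.Decidable using (map′; _×-dec_; _⊎-dec_; ¬?; decidable-stable)
open import Relation.Binary.Bundles using (DecTotalOrder)
open import Relation.Binary.Definitions using (DecidableEquality; tri<; tri≈; tri>)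
open import Relation.Binary.PropositionalEquality using (_≡_; _≢_; refl; sym; trans; cong; subst; subst₂)
import Data.Bool.Properties as Bool
import Data.Nat as ℕ
import Data.Fin as Fin
import Data.Fin.Properties as Fin
import Data.List.Membership.DecPropositional as DecMembership
import Data.List.Relation.Unary.Any as Any
import Data.List.Relation.Unary.Any.Properties as AnyP
import Data.List.Relation.Unary.All as All
import Data.List.Relation.Unary.All.Properties as AllP
import Data.List.Relation.Unary.Unique.Propositional.Properties as Unique
import Data.List.Relation.Unary.Unique.DecPropositional as DecUnique
import Data.List.Relation.Unary.Unique.DecPropositional.Properties as DecUniqueProperties
import Data.List.Sort as Sort
import Data.List.Relation.Unary.Sorted.TotalOrder.Properties as Sorted
import Data.Sum.Properties as Sum
import Relation.Binary.Construct.On as On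

-- Duplicate-free lists, counting and least numbers

extract : {A : Set} {x : A} {xs : List A} → Unique xs → x ∈ xs →
  Σ (List A) λ ys → Unique ys × length xs ≡ suc (length ys) × (∀ {y} → y ∈ ys → y ∈ xs × y ≢ x)
extract {xs = _ ∷ xs} (x∉xs ∷ u) (here refl) =
  xs , u , refl , λ y∈xs → there y∈xs , λ { refl → All.lookup x∉xs y∈xs refl }
extract {x = x} {xs = z ∷ xs} (z∉xs ∷ u) (there x∈xs) with extract u x∈xs
... | ys , uys , len , sub =
  z ∷ ys , All.tabulate (λ y∈ys → All.lookup z∉xs (proj₁ (sub y∈ys))) ∷ uys , cong suc len , sub′
  where
  sub′ : ∀ {y} → y ∈ z ∷ ys → y ∈ z ∷ xs × y ≢ x
  sub′ (here refl) = here refl , λ { refl → All.lookup z∉xs x∈xs refl }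
  sub′ (there y∈ys) = there (proj₁ (sub y∈ys)) , proj₂ (sub y∈ys)

delete : {A : Set} {x : A} {xs : List A} → x ∈ xs →
  Σ (List A) λ ys → length xs ≡ suc (length ys) × (∀ {y} → y ∈ xs → y ≢ x → y ∈ ys)
delete {xs = _ ∷ xs} (here refl) =
  xs , refl , λ { (here refl) y≢x → ⊥-elim (y≢x refl) ; (there y∈xs) _ → y∈xs }
delete {xs = z ∷ xs} (there x∈xs) with delete x∈xs
... | ys , len , sub =
  z ∷ ys , cong suc len , λ { (here refl) _ → here refl ; (there y∈xs) y≢x → there (sub y∈xs y≢x) }

-- The matching is a relation because a vertex only has some suitable partner, with no preferred
-- one. One occurrence of the partner `y` of the head is deleted from `ys`; no later entry asks for
-- it, since no two distinct entries are related to `y`.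
length≤-by-injection : {A : Set} (R : A → A → Set) {xs ys : List A} → Unique xs →
  (∀ {x} → x ∈ xs → ∃ λ y → y ∈ ys × R x y) →
  (∀ {x x′ y} → x ∈ xs → x′ ∈ xs → R x y → R x′ y → x ≡ x′) →
  length xs ≤ length ys
length≤-by-injection R {[]} _ _ _ = z≤n
length≤-by-injection R {x ∷ xs} {ys} (x∉xs ∷ u) image inj with image (here refl)
... | y , y∈ys , Rxy with delete y∈ys
... | zs , len , sub rewrite len = s≤s (length≤-by-injection R u image′ λ p q → inj (there p) (there q))
  where
  image′ : ∀ {x′} → x′ ∈ xs → ∃ λ z → z ∈ zs × R x′ z
  image′ x′∈xs with image (there x′∈xs)
  ... | z , z∈ys , Rx′z =
    z , sub z∈ys (λ { refl → All.lookup x∉xs x′∈xs (inj (here refl) (there x′∈xs) Rxy Rx′z) }) , Rx′z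

least : {Q : ℕ → Set} → (∀ k → Dec (Q k)) → ∀ {m} → Q m →
  Σ ℕ λ k → Q k × (∀ j → Q j → k ≤ j)
-- The witness `m` is the fuel: by the invariant `Q (fuel + k)`, `Q` holds at `k` once the fuel is
-- spent.
least {Q} Q? {m} q₀ = search m zero (λ _ _ → z≤n) (subst Q (sym (+-identityʳ m)) q₀)
  where
  search : ∀ fuel k → (∀ j → Q j → k ≤ j) → Q (fuel + k) → Σ ℕ λ k → Q k × (∀ j → Q j → k ≤ j)
  search zero k lower q = k , q , lower
  search (suc fuel) k lower q with Q? k
  ... | yes qk = k , qk , lower
  ... | no ¬qk = search fuel (suc k) lower′ (subst Q (sym (+-suc fuel k)) q)
    where
    lower′ : ∀ j → Q j → suc k ≤ j
    lower′ j qj with m≤n⇒m<n∨m≡n (lower j qj)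
    ... | inj₁ k<j = k<j
    ... | inj₂ refl = ⊥-elim (¬qk qj)

-- Finite graphs, weak duality and certificates for the change of γt

record Finite (G : Graph) : Set where
  field
    _≟_      : DecidableEquality (V G)
    adj?     : ∀ u v → Dec (Adj G u v)
    vertices : List (V G)
    complete : ∀ v → v ∈ vertices

NoIsolated : Graph → Set
NoIsolated G = ∀ v → ∃ λ w → Adj G v w

IsPacking : (G : Graph) → List (V G) → Set
IsPacking G P = Unique P × (∀ {p q z} → p ∈ P → q ∈ P → Adj G p z → Adj G q z → p ≡ q)

-- Every member of `P` has a neighbour in `S`, and no two members can share one.
packing≤TDS : (G : Graph) {P S : List (V G)} → IsPacking G P → IsTDS G S → length P ≤ length S
packing≤TDS G (u , inj) (_ , dominated) = length≤-by-injection (Adj G) u (λ {p} _ → dominated p) inj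

γt-unique : ∀ {G k l} → IsγtValue G k → IsγtValue G l → k ≡ l
γt-unique ((S , tdsS , refl) , minS) ((S′ , tdsS′ , refl) , minS′) =
  ≤-antisym (minS S′ tdsS′) (minS′ S tdsS)

module _ {G : Graph} (fin : Finite G) where
  open Finite fin

  findVertex : {Q : V G → Set} → (∀ v → Dec (Q v)) → Dec (∃ Q)
  findVertex Q? = map′ (λ a → proj₁ (find a) , proj₂ (proj₂ (find a)))
    (λ { (v , q) → lose (complete v) q }) (any? Q? vertices)

  allVertices : {Q : V G → Set} → (∀ v → Dec (Q v)) → Dec (∀ v → Q v)
  allVertices Q? = map′ (λ a v → All.lookup a (complete v)) (λ q → All.tabulate λ {v} _ → q v)
    (all? Q? vertices)

  dominated? : (S : List (V G)) → ∀ v → Dec (∃ λ u → u ∈ S × Adj G v u)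
  dominated? S v = map′ find (λ { (_ , u∈S , vu) → lose u∈S vu }) (any? (adj? v) S)

  findList : ∀ k {Q : List (V G) → Set} → (∀ S → Dec (Q S)) → Dec (∃ λ S → Q S × length S ≡ k)
  findList zero Q? = map′ (λ q → [] , q , refl) (λ { ([] , q , refl) → q }) (Q? [])
  findList (suc k) Q? = map′
    (λ { (v , S , q , refl) → v ∷ S , q , refl })
    (λ { (v ∷ S , q , refl) → v , S , q , refl })
    (findVertex λ v → findList k (Q? ∘ (v ∷_)))

  isTDS? : ∀ S → Dec (IsTDS G S)
  isTDS? S = DecUnique.unique? _≟_ S ×-dec allVertices (dominated? S)

  dedup-TDS : (S : List (V G)) → (∀ v → ∃ λ u → u ∈ S × Adj G v u) → IsTDS G (deduplicate _≟_ S)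
  dedup-TDS S dominated = DecUniqueProperties.deduplicate-! _≟_ S ,
    λ v → let (u , u∈S , vu) = dominated v in u , ∈-deduplicate⁺ _≟_ u∈S , vu

  -- Without isolated vertices the full vertex set dominates, which bounds the search for the least
  -- size.
  γt-exists : NoIsolated G → ∃ (IsγtValue G)
  γt-exists noIso = k , tds , λ S tdsS → minimal (length S) (S , tdsS , refl)
    where
    all-TDS = dedup-TDS vertices λ v → let (w , vw) = noIso v in w , complete w , vw
    found = least (λ k → findList k isTDS?) (_ , all-TDS , refl)
    k = proj₁ found
    tds = proj₁ (proj₂ found)
    minimal = proj₂ (proj₂ found)

  -- Deduplication only shortens `S`, so the image of a packing under a map can serve as `S`
  -- directly.
  γt≤ : ∀ {k} → IsγtValue G k → (S : List (V G)) → (∀ v → ∃ λ u → u ∈ S × Adj G v u) → k ≤ length S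
  γt≤ (_ , minimal) S dominated =
    ≤-trans (minimal _ (dedup-TDS S dominated)) (length-deduplicate _≟_ S)

bump : ∀ {G G′ k} → IsγtValue G k → Finite G′ → NoIsolated G′ → {P : List (V G′)} →
  IsPacking G′ P → k < length P → γtIncreases G G′
bump {k = k} γ fin noIso packing k<P with γt-exists fin noIso
... | k′ , γ′@((S , tds , refl) , _) = k , k′ , γ , γ′ , <-≤-trans k<P (packing≤TDS _ packing tds)

no-bump : ∀ {G G′ k} → IsγtValue G k → Finite G′ → (S : List (V G′)) →
  (∀ v → ∃ λ u → u ∈ S × Adj G′ v u) → length S ≤ k → ¬ γtIncreases G G′
no-bump γ fin S dominated S≤k (_ , _ , γ₁ , γ₂ , k<k′) rewrite γt-unique γ₁ γ =
  <⇒≱ k<k′ (≤-trans (γt≤ fin γ₂ S dominated) S≤k)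

-- Duality of total domination and open packing on trees

-- `dep` has to decrease towards the root but need not be the distance, which leaves room for the
-- offset used when the root changes. `orient` carries the acyclicity: every edge joins a vertex to
-- its parent. The value of `up` at `r` is arbitrary.
record Rooting (G : Graph) (r : V G) : Set where
  field
    up     : V G → V G
    dep    : V G → ℕ
    up-adj : ∀ {v} → v ≢ r → Adj G v (up v)
    up-dep : ∀ {v} → v ≢ r → dep (up v) < dep v
    orient : ∀ {u v} → Adj G u v → (u ≢ r × up u ≡ v) ⊎ (v ≢ r × up v ≡ u)

module Duality {G : Graph} (fin : Finite G) (noIso : NoIsolated G) {r : V G} (R : Rooting G r) where
  open Finite fin
  open Rooting R

  Dominated : List (V G) → V G → Set
  Dominated D v = ∃ λ u → u ∈ D × Adj G v u

  -- `up∈D` is what keeps `P` a packing: a vertex treated later that shares the neighbour `up p`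
  -- with some `p` in `P` is already dominated and never enters `P`.
  record Partial (L : List (V G)) : Set where
    field
      D P       : List (V G)
      D-unique  : Unique D
      equal     : length D ≡ length P
      packing   : IsPacking G P
      P⊆L       : ∀ {p} → p ∈ P → p ∈ L
      dominated : ∀ {v} → v ∈ L → Dominated D v
      up∈D      : ∀ {p} → p ∈ P → p ≢ r → up p ∈ D

  chosen : ∀ v → ∃ λ w → Adj G v w × (v ≢ r → up v ≡ w)
  chosen v with v ≟ r
  ... | no v≢r = up v , up-adj v≢r , λ _ → refl
  ... | yes v≡r = let (w , vw) = noIso v in w , vw , λ v≢r → ⊥-elim (v≢r v≡r)

  -- Deepest vertices come last in the list and are treated first.
  greedy : ∀ L → AllPairs (λ u v → dep u ≤ dep v) L → Partial L
  greedy [] _ = record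
    { D = [] ; P = [] ; D-unique = [] ; equal = refl ; packing = [] , λ ()
    ; P⊆L = λ () ; dominated = λ () ; up∈D = λ () }
  greedy (v ∷ L) (v≤L ∷ sorted) with greedy L sorted
  ... | rest with dominated? fin (Partial.D rest) v
  ... | yes v-dominated = record
    { Partial rest hiding (P⊆L; dominated)
    ; P⊆L = there ∘ P⊆L
    ; dominated = λ { (here refl) → v-dominated ; (there x∈L) → dominated x∈L } }
    where open Partial rest
  ... | no ¬dominated = record
    { D = w ∷ D
    ; P = v ∷ P
    ; D-unique = All.tabulate (λ { u∈D refl → ¬dominated (w , u∈D , vw) }) ∷ D-unique
    ; equal = cong suc equal
    ; packing = (All.tabulate fresh ∷ proj₁ packing) , separated
    ; P⊆L = λ { (here refl) → here refl ; (there p∈P) → there (P⊆L p∈P) }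
    ; dominated = λ { (here refl) → w , here refl , vw
                    ; (there x∈L) → let (u , u∈D , xu) = dominated x∈L in u , there u∈D , xu }
    ; up∈D = λ { (here refl) v≢r → here (upv v≢r) ; (there p∈P) p≢r → there (up∈D p∈P p≢r) } }
    where
    open Partial rest
    w = proj₁ (chosen v)
    vw = proj₁ (proj₂ (chosen v))
    upv = proj₂ (proj₂ (chosen v))
    fresh : ∀ {p} → p ∈ P → v ≢ p
    fresh p∈P refl = ¬dominated (dominated (P⊆L p∈P))
    -- A common neighbour of v and p is the parent of p, which already dominates v.
    v≁P : ∀ {p z} → p ∈ P → Adj G v z → Adj G p z → ⊥
    v≁P {p} {z} p∈P vz pz with orient pz
    ... | inj₁ (p≢r , refl) = ¬dominated (z , up∈D p∈P p≢r , vz)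
    -- Otherwise `p` is the parent of `z`. If `z` is the parent of `v`, then `p` is shallower than
    -- `v`, against the sorting; if `v` is the parent of `z`, then `v` and `p` coincide.
    ... | inj₂ (z≢r , refl) with orient vz
    ... | inj₁ (v≢r , refl) = <⇒≱ (<-trans (up-dep z≢r) (up-dep v≢r)) (All.lookup v≤L (P⊆L p∈P))
    ... | inj₂ (_ , refl) = fresh p∈P refl
    separated : ∀ {p q z} → p ∈ v ∷ P → q ∈ v ∷ P → Adj G p z → Adj G q z → p ≡ q
    separated (here refl) (here refl) _ _ = refl
    separated (here refl) (there q∈P) vz qz = ⊥-elim (v≁P q∈P vz qz)
    separated (there p∈P) (here refl) pz vz = ⊥-elim (v≁P p∈P vz pz)
    separated (there p∈P) (there q∈P) pz qz = proj₂ packing p∈P q∈P pz qz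

  private
    byDepth : DecTotalOrder _ _ _
    byDepth = On.decTotalOrder ≤-decTotalOrder dep

    open Sort byDepth using (sort; sort-↭; sort-↗)

  -- `D` and `P` have equal size, so weak duality makes `D` minimum.
  γt-packing : Σ (List (V G)) λ P → IsPacking G P × IsγtValue G (length P)
  γt-packing = P , packing , (D , (D-unique , all-dominated) , equal) ,
    λ S tds → packing≤TDS G packing tds
    where
    open Partial (greedy (sort vertices)
      (Sorted.Sorted⇒AllPairs (DecTotalOrder.totalOrder byDepth) (sort-↗ vertices)))
    all-dominated : ∀ v → Dominated D v
    all-dominated v = dominated (∈-resp-↭ (↭-sym (sort-↭ vertices)) (complete v))

-- Rooting a tree by distance

module BreadthFirst {G : Graph} (fin : Finite G) (G-sym : ∀ {u v} → Adj G u v → Adj G v u)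
    (irrefl : ∀ {v} → ¬ Adj G v v) (tree : IsTree G) (r : V G) where
  open Finite fin

  Reach : ℕ → V G → Set
  Reach zero v = v ≡ r
  Reach (suc k) v = ∃ λ u → Adj G v u × Reach k u

  reach? : ∀ k v → Dec (Reach k v)
  reach? zero v = v ≟ r
  reach? (suc k) v = findVertex fin λ u → adj? v u ×-dec reach? k u

  walk-reach : ∀ {v} → Walk G v r → ∃ λ k → Reach k v
  walk-reach here = zero , refl
  walk-reach (step vw walk) = let (k , reach) = walk-reach walk in suc k , _ , vw , reach

  shortest : ∀ v → Σ ℕ λ k → Reach k v × (∀ j → Reach j v → k ≤ j)
  shortest v = least (λ k → reach? k v) (proj₂ (walk-reach (proj₁ tree v r)))

  dep : V G → ℕ
  dep v = proj₁ (shortest v)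

  dep-reach : ∀ v → Reach (dep v) v
  dep-reach v = proj₁ (proj₂ (shortest v))

  dep-least : ∀ {v k} → Reach k v → dep v ≤ k
  dep-least {v} = proj₂ (proj₂ (shortest v)) _

  dep≤ : ∀ {u v} → Adj G u v → dep u ≤ suc (dep v)
  dep≤ {v = v} uv = dep-least (v , uv , dep-reach v)

  -- Recursion runs on a free `k` because `dep v` does not reduce. The value at zero is a default,
  -- met only at the root.
  first-step : ∀ k {v} → Reach k v → V G
  first-step zero {v} _ = v
  first-step (suc k) (u , _) = u

  up : V G → V G
  up v = first-step (dep v) (dep-reach v)

  up-spec : ∀ {v} → v ≢ r → Adj G v (up v) × dep v ≡ suc (dep (up v))
  up-spec {v} v≢r = go (dep v) (dep-reach v) refl
    where
    go : ∀ k (reach : Reach k v) → dep v ≡ k →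
      Adj G v (first-step k reach) × dep v ≡ suc (dep (first-step k reach))
    go zero v≡r _ = ⊥-elim (v≢r v≡r)
    go (suc k) (u , vu , reach) eq =
      vu , ≤-antisym (dep≤ vu) (≤-trans (s≤s (dep-least reach)) (≤-reflexive (sym eq)))

  snoc : ∀ {a b c} M → Linked (Adj G) (a ∷ M ++ [ b ]) → Adj G b c →
    Linked (Adj G) (a ∷ (M ++ [ b ]) ++ [ c ])
  snoc [] (ab ∷ _) bc = ab ∷ bc ∷ [-]
  snoc (_ ∷ M) (am ∷ path) bc = am ∷ snoc M path bc

  record Detour (k : ℕ) (a b : V G) : Set where
    field
      inner    : List (V G)
      nonempty : 1 ≤ length inner
      shallow  : All (λ v → dep v < k) inner
      unique   : Unique (a ∷ inner ++ [ b ])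
      linked   : Linked (Adj G) (a ∷ inner ++ [ b ])

  -- Both vertices step up to their parents, which either coincide or are joined by a detour one
  -- level higher. All inner vertices are strictly closer to `r`, so `a` and `b` do not recur. Level
  -- zero holds only the root.
  detour : ∀ k {a b} → dep a ≡ k → dep b ≡ k → a ≢ b → Detour k a b
  detour zero {a} {b} da db a≢b = ⊥-elim (a≢b (trans (root da) (sym (root db))))
    where
    root : ∀ {v} → dep v ≡ zero → v ≡ r
    root {v} dv = subst (λ k → Reach k v) dv (dep-reach v)
  detour (suc k) {a} {b} da db a≢b = extend (up a ≟ up b)
    where
    deep : ∀ {v} → dep v ≡ suc k → v ≢ r
    deep dv refl with ≤-trans (≤-reflexive (sym dv)) (dep-least {r} {0} refl)
    ... | ()
    spec-a = up-spec (deep da)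
    spec-b = up-spec (deep db)
    dua : dep (up a) ≡ k
    dua = suc-injective (trans (sym (proj₂ spec-a)) da)
    dub : dep (up b) ≡ k
    dub = suc-injective (trans (sym (proj₂ spec-b)) db)
    prepend : ∀ M → All (λ v → dep v < suc k) M → Unique M → Unique (a ∷ M ++ [ b ])
    prepend M below u = All.tabulate a≢ ∷ Unique.++⁺ u ([] ∷ []) λ { (v∈M , here refl) → bad db (All.lookup below v∈M) }
      where
      bad : ∀ {v} → dep v ≡ suc k → ¬ (dep v < suc k)
      bad dv lt = <-irrefl dv lt
      a≢ : ∀ {v} → v ∈ M ++ [ b ] → a ≢ v
      a≢ v∈ refl with ∈-++⁻ M v∈
      ... | inj₁ a∈M = bad da (All.lookup below a∈M)
      ... | inj₂ (here a≡b) = a≢b a≡b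
    extend : Dec (up a ≡ up b) → Detour (suc k) a b
    extend (yes ua≡ub) = record
      { inner = [ up a ] ; nonempty = s≤s z≤n ; shallow = below
      ; unique = prepend _ below ([] ∷ [])
      ; linked = proj₁ spec-a ∷ subst (λ z → Adj G z b) (sym ua≡ub) (G-sym (proj₁ spec-b)) ∷ [-] }
      where
      below = s≤s (≤-reflexive dua) ∷ []
    extend (no ua≢ub) = record
      { inner = up a ∷ inner ++ [ up b ] ; nonempty = s≤s z≤n ; shallow = below
      ; unique = prepend _ below unique
      ; linked = proj₁ spec-a ∷ snoc inner linked (G-sym (proj₁ spec-b)) }
      where
      open Detour (detour k dua dub ua≢ub)
      below = s≤s (≤-reflexive dua) ∷ AllP.++⁺ (All.map m≤n⇒m≤1+n shallow) (s≤s (≤-reflexive dub) ∷ [])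

  -- Such an edge would close the detour between its ends to a cycle; `nonempty` supplies the third
  -- vertex.
  no-level-edge : ∀ {u v} → Adj G u v → dep u ≢ dep v
  no-level-edge {u} {v} uv eq = proj₂ tree u (inner ++ [ v ])
    (long inner nonempty , unique , snoc inner linked (G-sym uv))
    where
    u≢v : u ≢ v
    u≢v refl = irrefl uv
    open Detour (detour (dep u) refl (sym eq) u≢v)
    long : ∀ M → 1 ≤ length M → 2 ≤ length (M ++ [ v ])
    long (_ ∷ []) _ = s≤s (s≤s z≤n)
    long (_ ∷ _ ∷ _) _ = s≤s (s≤s z≤n)

  -- A detour between two distinct parents stays above the level of `u`, and `u` would close it to a
  -- cycle.
  unique-up : ∀ {u a b} → Adj G u a → Adj G u b → dep u ≡ suc (dep a) → dep u ≡ suc (dep b) → a ≡ b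
  unique-up {u} {a} {b} ua ub da db with a ≟ b
  ... | yes a≡b = a≡b
  ... | no a≢b = ⊥-elim (proj₂ tree u (a ∷ inner ++ [ b ])
    (long inner , (All.map (λ lt → λ { refl → <-irrefl refl lt }) below ∷ unique) , ua ∷ snoc inner linked (G-sym ub)))
    where
    open Detour (detour (dep a) refl (suc-injective (trans (sym db) da)) a≢b)
    long : ∀ M → 2 ≤ length (a ∷ M ++ [ b ])
    long [] = s≤s (s≤s z≤n)
    long (_ ∷ _) = s≤s (s≤s z≤n)
    below : All (λ v → dep v < dep u) (a ∷ inner ++ [ b ])
    below = ≤-reflexive (sym da) ∷
      AllP.++⁺ (All.map (λ lt → <-trans lt (≤-reflexive (sym da))) shallow) (≤-reflexive (sym db) ∷ [])

  up-unique : ∀ {u v} → Adj G u v → dep v < dep u → u ≢ r × up u ≡ v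
  up-unique {u} {v} uv lt = u≢r , unique-up (proj₁ spec) uv (proj₂ spec) (≤-antisym (dep≤ uv) lt)
    where
    u≢r : u ≢ r
    u≢r refl with ≤-trans lt (dep-least {r} {0} refl)
    ... | ()
    spec = up-spec u≢r

  rooting : Rooting G r
  rooting = record
    { up = up ; dep = dep
    ; up-adj = proj₁ ∘ up-spec
    ; up-dep = λ v≢r → ≤-reflexive (sym (proj₂ (up-spec v≢r)))
    ; orient = orient }
    where
    orient : ∀ {u v} → Adj G u v → (u ≢ r × up u ≡ v) ⊎ (v ≢ r × up v ≡ u)
    orient {u} {v} uv with <-cmp (dep u) (dep v)
    ... | tri< lt _ _ = inj₂ (up-unique (G-sym uv) lt)
    ... | tri≈ _ eq _ = ⊥-elim (no-level-edge uv eq)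
    ... | tri> _ _ gt = inj₁ (up-unique uv gt)

-- Subdivided graphs and their packings

sameEdge? : {A : Set} → DecidableEquality A → (e f : A × A) → Dec (SameEdge e f)
sameEdge? _≟_ (a , b) (c , d) = (a ≟ c ×-dec b ≟ d) ⊎-dec (a ≟ d ×-dec b ≟ c)

SameEdge-swap : {A : Set} {a b c d : A} → SameEdge (a , b) (c , d) → SameEdge (b , a) (c , d)
SameEdge-swap (inj₁ (p , q)) = inj₂ (q , p)
SameEdge-swap (inj₂ (p , q)) = inj₁ (q , p)

module _ {G : Graph} (fin : Finite G) where
  open Finite fin

  private
    withNew : ∀ {m} (adj : V G ⊎ Fin m → V G ⊎ Fin m → Set) → (∀ x y → Dec (adj x y)) →
      Finite (record { V = V G ⊎ Fin m ; Adj = adj })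
    withNew {m} adj adjacent? = record
      { _≟_ = Sum.≡-dec _≟_ Fin._≟_
      ; adj? = adjacent?
      ; vertices = map inj₁ vertices ++ map inj₂ (allFin m)
      ; complete = λ { (inj₁ v) → ∈-++⁺ˡ (∈-map⁺ inj₁ (complete v))
                     ; (inj₂ i) → ∈-++⁺ʳ (map inj₁ vertices) (∈-map⁺ inj₂ (∈-allFin i)) } }

  subdivide-finite : ∀ F → Finite (subdivide G F)
  subdivide-finite F = withNew (Adj (subdivide G F)) adjacent?
    where
    adjacent? : ∀ x y → Dec (Adj (subdivide G F) x y)
    adjacent? (inj₁ a) (inj₁ b) = adj? a b ×-dec ¬? (any? (sameEdge? _≟_ (a , b)) F)
    adjacent? (inj₁ a) (inj₂ i) = a ≟ proj₁ (lookup F i) ⊎-dec a ≟ proj₂ (lookup F i)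
    adjacent? (inj₂ i) (inj₁ a) = a ≟ proj₁ (lookup F i) ⊎-dec a ≟ proj₂ (lookup F i)
    adjacent? (inj₂ i) (inj₂ j) = no λ ()

  subdivideEdge-finite : ∀ u v t → Finite (subdivideEdge G u v t)
  subdivideEdge-finite u v t = withNew (Adj (subdivideEdge G u v t)) adjacent?
    where
    attached? : ∀ a (i : Fin t) → Dec ((a ≡ u × toℕ i ≡ 0) ⊎ (a ≡ v × suc (toℕ i) ≡ t))
    attached? a i = (a ≟ u ×-dec toℕ i ℕ.≟ 0) ⊎-dec (a ≟ v ×-dec suc (toℕ i) ℕ.≟ t)
    adjacent? : ∀ x y → Dec (Adj (subdivideEdge G u v t) x y)
    adjacent? (inj₁ a) (inj₁ b) = adj? a b ×-dec ¬? (sameEdge? _≟_ (a , b) (u , v))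
    adjacent? (inj₁ a) (inj₂ i) = attached? a i
    adjacent? (inj₂ i) (inj₁ a) = attached? a i
    adjacent? (inj₂ i) (inj₂ j) = suc (toℕ i) ℕ.≟ toℕ j ⊎-dec suc (toℕ j) ℕ.≟ toℕ i

  subdivide-noIso : NoIsolated G → ∀ F → NoIsolated (subdivide G F)
  subdivide-noIso noIso F (inj₂ i) = inj₁ (proj₁ (lookup F i)) , inj₁ refl
  subdivide-noIso noIso F (inj₁ v) with noIso v
  ... | w , vw with any? (sameEdge? _≟_ (v , w)) F
  ... | no uncut = inj₁ w , vw , uncut
  ... | yes cut = inj₂ (index cut) , end (AnyP.lookup-index cut)
    where
    end : ∀ {e} → SameEdge (v , w) e → v ≡ proj₁ e ⊎ v ≡ proj₂ e
    end (inj₁ (p , _)) = inj₁ p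
    end (inj₂ (p , _)) = inj₂ p

  subdivideEdge-noIso : NoIsolated G → ∀ u v t → NoIsolated (subdivideEdge G u v (suc t))
  subdivideEdge-noIso noIso u v t (inj₂ zero) = inj₁ u , inj₁ (refl , refl)
  subdivideEdge-noIso noIso u v t (inj₂ (suc i)) = inj₂ (inject₁ i) , inj₂ (cong suc (toℕ-inject₁ i))
  subdivideEdge-noIso noIso u v t (inj₁ x) with noIso x
  ... | w , xw with sameEdge? _≟_ (x , w) (u , v)
  ... | no uncut = inj₁ w , xw , uncut
  ... | yes (inj₁ (refl , _)) = inj₂ zero , inj₁ (refl , refl)
  ... | yes (inj₂ (refl , _)) = inj₂ (fromℕ t) , inj₂ (refl , cong suc (toℕ-fromℕ t))

-- `subdivide G [ u , v ]` and `subdivideEdge G u v 1` share their vertex type, but their adjacency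
-- relations are only equivalent.
IsγtValue-resp : {X : Set} {A B : X → X → Set} → (∀ {x y} → A x y → B x y) → (∀ {x y} → B x y → A x y) →
  ∀ {k} → IsγtValue (record { V = X ; Adj = A }) k → IsγtValue (record { V = X ; Adj = B }) k
IsγtValue-resp {X} A⇒B B⇒A ((S , tds , len) , minimal) =
  (S , mono A⇒B tds , len) , λ S′ tds′ → minimal S′ (mono B⇒A tds′)
  where
  mono : {A B : X → X → Set} → (∀ {x y} → A x y → B x y) → ∀ {S} →
    IsTDS (record { V = X ; Adj = A }) S → IsTDS (record { V = X ; Adj = B }) S
  mono A⇒B (unique , dominated) =
    unique , λ v → let (u , u∈S , vu) = dominated v in u , u∈S , A⇒B vu

module _ {G : Graph} {u v : V G} where
  private
    list⇒edge : ∀ {x y} → Adj (subdivide G [ u , v ]) x y → Adj (subdivideEdge G u v 1) x y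
    list⇒edge {inj₁ _} {inj₁ _} (ab , uncut) = ab , uncut ∘ here
    list⇒edge {inj₁ _} {inj₂ zero} (inj₁ p) = inj₁ (p , refl)
    list⇒edge {inj₁ _} {inj₂ zero} (inj₂ p) = inj₂ (p , refl)
    list⇒edge {inj₂ zero} {inj₁ _} (inj₁ p) = inj₁ (p , refl)
    list⇒edge {inj₂ zero} {inj₁ _} (inj₂ p) = inj₂ (p , refl)

    edge⇒list : ∀ {x y} → Adj (subdivideEdge G u v 1) x y → Adj (subdivide G [ u , v ]) x y
    edge⇒list {inj₁ _} {inj₁ _} (ab , uncut) = ab , λ { (here same) → uncut same }
    edge⇒list {inj₁ _} {inj₂ zero} (inj₁ (p , _)) = inj₁ p
    edge⇒list {inj₁ _} {inj₂ zero} (inj₂ (p , _)) = inj₂ p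
    edge⇒list {inj₂ zero} {inj₁ _} (inj₁ (p , _)) = inj₁ p
    edge⇒list {inj₂ zero} {inj₁ _} (inj₂ (p , _)) = inj₂ p
    edge⇒list {inj₂ zero} {inj₂ zero} (inj₁ ())
    edge⇒list {inj₂ zero} {inj₂ zero} (inj₂ ())

  single⇒edge : γtIncreases G (subdivide G [ u , v ]) → γtIncreases G (subdivideEdge G u v 1)
  single⇒edge (k , k′ , γ , γ′ , lt) =
    k , k′ , γ , IsγtValue-resp (λ {x} {y} → list⇒edge {x} {y}) (λ {x} {y} → edge⇒list {x} {y}) γ′ , lt

  edge⇒single : γtIncreases G (subdivideEdge G u v 1) → γtIncreases G (subdivide G [ u , v ])
  edge⇒single (k , k′ , γ , γ′ , lt) =
    k , k′ , γ , IsγtValue-resp (λ {x} {y} → edge⇒list {x} {y}) (λ {x} {y} → list⇒edge {x} {y}) γ′ , lt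

module _ {G : Graph} {Q : List (V G)} (unique : Unique Q) where
  private
    old-unique : ∀ {X : Set} → Unique (map (inj₁ {B = X}) Q)
    old-unique = Unique.map⁺ inj₁-injective unique

  module _ (F : List (V G × V G))
      (separated : ∀ {p q z} → p ∈ Q → q ∈ Q → Adj G p z → Adj G q z →
        ¬ Any (SameEdge (p , z)) F → ¬ Any (SameEdge (q , z)) F → p ≡ q)
      (ends : All (λ e → ¬ (proj₁ e ∈ Q × proj₂ e ∈ Q)) F) where

    -- Two old vertices share a new neighbour only as the two ends of one edge of `F`, which `ends`
    -- excludes. Old common neighbours count only along uncut edges, so `Q` may fail to be a packing
    -- of `G`.
    subdivide-packing : IsPacking (subdivide G F) (map inj₁ Q)
    subdivide-packing = old-unique , sep
      where
      sep : ∀ {p q z} → p ∈ map inj₁ Q → q ∈ map inj₁ Q →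
        Adj (subdivide G F) p z → Adj (subdivide G F) q z → p ≡ q
      sep p∈ q∈ pz qz with ∈-map⁻ inj₁ p∈ | ∈-map⁻ inj₁ q∈
      sep {z = inj₁ z} p∈ q∈ (pz , p-uncut) (qz , q-uncut) | p , p∈Q , refl | q , q∈Q , refl =
        cong inj₁ (separated p∈Q q∈Q pz qz p-uncut q-uncut)
      sep {z = inj₂ i} p∈ q∈ pz qz | p , p∈Q , refl | q , q∈Q , refl with pz | qz
      ... | inj₁ refl | inj₁ refl = refl
      ... | inj₂ refl | inj₂ refl = refl
      ... | inj₁ refl | inj₂ refl = ⊥-elim (All.lookup ends (∈-lookup {xs = F} i) (p∈Q , q∈Q))
      ... | inj₂ refl | inj₁ refl = ⊥-elim (All.lookup ends (∈-lookup {xs = F} i) (q∈Q , p∈Q))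

    -- The new vertex sees only the ends of its edge, and it joins `Q` once every edge from `Q` to
    -- these ends is cut.
    subdivide-packing-new : (i : Fin (length F)) →
      (∀ {p} → p ∈ Q → Adj G p (proj₁ (lookup F i)) → Any (SameEdge (p , proj₁ (lookup F i))) F) →
      (∀ {p} → p ∈ Q → Adj G p (proj₂ (lookup F i)) → Any (SameEdge (p , proj₂ (lookup F i))) F) →
      IsPacking (subdivide G F) (inj₂ i ∷ map inj₁ Q)
    subdivide-packing-new i cut₁ cut₂ =
      (All.tabulate fresh ∷ proj₁ subdivide-packing) , sep
      where
      fresh : ∀ {p} → p ∈ map inj₁ Q → inj₂ i ≢ p
      fresh p∈ refl with ∈-map⁻ inj₁ p∈
      ... | _ , _ , ()
      x≁ : ∀ {p z} → p ∈ map inj₁ Q → Adj (subdivide G F) (inj₂ i) z → Adj (subdivide G F) p z → ⊥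
      x≁ {z = inj₁ z} p∈ xz pz with ∈-map⁻ inj₁ p∈
      x≁ {z = inj₁ z} p∈ (inj₁ refl) (pz , uncut) | p , p∈Q , refl = uncut (cut₁ p∈Q pz)
      x≁ {z = inj₁ z} p∈ (inj₂ refl) (pz , uncut) | p , p∈Q , refl = uncut (cut₂ p∈Q pz)
      sep : ∀ {p q z} → p ∈ inj₂ i ∷ map inj₁ Q → q ∈ inj₂ i ∷ map inj₁ Q →
        Adj (subdivide G F) p z → Adj (subdivide G F) q z → p ≡ q
      sep (here refl) (here refl) _ _ = refl
      sep (here refl) (there q∈) xz qz = ⊥-elim (x≁ q∈ xz qz)
      sep (there p∈) (here refl) pz xz = ⊥-elim (x≁ p∈ xz pz)
      sep (there p∈) (there q∈) pz qz = proj₂ subdivide-packing p∈ q∈ pz qz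

  module _ (u v : V G) (t : ℕ)
      (separated : ∀ {p q z} → p ∈ Q → q ∈ Q → Adj G p z → Adj G q z →
        ¬ SameEdge (p , z) (u , v) → ¬ SameEdge (q , z) (u , v) → p ≡ q) where
    private
      G′ = subdivideEdge G u v (suc (suc t))

    -- With at least two new vertices, none of them touches both `u` and `v`.
    subdivideEdge-packing : IsPacking G′ (map inj₁ Q)
    subdivideEdge-packing = old-unique , sep
      where
      sep : ∀ {p q z} → p ∈ map inj₁ Q → q ∈ map inj₁ Q → Adj G′ p z → Adj G′ q z → p ≡ q
      sep p∈ q∈ pz qz with ∈-map⁻ inj₁ p∈ | ∈-map⁻ inj₁ q∈
      sep {z = inj₁ z} p∈ q∈ (pz , p-uncut) (qz , q-uncut) | p , p∈Q , refl | q , q∈Q , refl =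
        cong inj₁ (separated p∈Q q∈Q pz qz p-uncut q-uncut)
      sep {z = inj₂ i} p∈ q∈ pz qz | p , p∈Q , refl | q , q∈Q , refl with pz | qz
      ... | inj₁ (refl , _) | inj₁ (refl , _) = refl
      ... | inj₂ (refl , _) | inj₂ (refl , _) = refl
      ... | inj₁ (_ , i≡0) | inj₂ (_ , eq) with trans (cong suc (sym i≡0)) eq
      ... | ()
      sep {z = inj₂ i} p∈ q∈ pz qz | p , p∈Q , refl | q , q∈Q , refl
          | inj₂ (_ , eq) | inj₁ (_ , i≡0) with trans (cong suc (sym i≡0)) eq
      ... | ()

    -- The first new vertex is adjacent to `u` and to the second new vertex. Cutting `uv` leaves no
    -- member of `Q` at `u`, and the second new vertex touches `v` only if there are exactly two;
    -- hence the alternative `v ∉ Q ⊎ 1 ≤ t`.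
    subdivideEdge-packing-new : (∀ {p} → p ∈ Q → Adj G p u → p ≡ v) → v ∉ Q ⊎ 1 ≤ t →
      IsPacking G′ (inj₂ zero ∷ map inj₁ Q)
    subdivideEdge-packing-new only-v far =
      (All.tabulate fresh ∷ proj₁ subdivideEdge-packing) , sep
      where
      fresh : ∀ {p} → p ∈ map inj₁ Q → inj₂ zero ≢ p
      fresh p∈ refl with ∈-map⁻ inj₁ p∈
      ... | _ , _ , ()
      too-close : 1 ≡ suc t → v ∈ Q → ⊥
      too-close eq v∈Q = [ (λ v∉Q → v∉Q v∈Q) , <-irrefl (suc-injective eq) ]′ far
      x≁ : ∀ {p z} → p ∈ map inj₁ Q → Adj G′ (inj₂ zero) z → Adj G′ p z → ⊥
      x≁ {z = z} p∈ xz pz with ∈-map⁻ inj₁ p∈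
      x≁ {z = inj₁ z} p∈ (inj₁ (refl , _)) (pz , uncut) | p , p∈Q , refl =
        uncut (inj₂ (only-v p∈Q pz , refl))
      x≁ {z = inj₂ j} p∈ (inj₁ 1≡j) (inj₁ (_ , j≡0)) | p , p∈Q , refl with trans 1≡j j≡0
      ... | ()
      x≁ {z = inj₂ j} p∈ (inj₁ 1≡j) (inj₂ (refl , eq)) | p , p∈Q , refl =
        too-close (trans 1≡j (suc-injective eq)) p∈Q
      sep : ∀ {p q z} → p ∈ inj₂ zero ∷ map inj₁ Q → q ∈ inj₂ zero ∷ map inj₁ Q →
        Adj G′ p z → Adj G′ q z → p ≡ q
      sep (here refl) (here refl) _ _ = refl
      sep {z = z} (here refl) (there q∈) xz qz = ⊥-elim (x≁ {z = z} q∈ xz qz)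
      sep {z = z} (there p∈) (here refl) pz xz = ⊥-elim (x≁ {z = z} p∈ xz pz)
      sep {z = z} (there p∈) (there q∈) pz qz = proj₂ subdivideEdge-packing {z = z} p∈ q∈ pz qz

-- Lower bounds: packings that gain a vertex

-- On `P`, `π` exchanges the two members of each adjacent pair; `nonleaf` puts every leaf into `P`.
record Perfect (G : Graph) (P : List (V G)) : Set where
  field
    packing : IsPacking G P
    π       : V G → V G
    π∈P     : ∀ v → π v ∈ P
    π-adj   : ∀ v → Adj G v (π v)
    nonleaf : ∀ {v} → v ∉ P → ∃ λ w → Adj G v w × w ≢ π v

  π-unique : (∀ {u v} → Adj G u v → Adj G v u) → ∀ {v q} → q ∈ P → Adj G v q → π v ≡ q
  π-unique G-sym {v} q∈P vq = proj₂ packing (π∈P v) q∈P (G-sym (π-adj v)) (G-sym vq)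

module Bumps {G : Graph} (fin : Finite G) (noIso : NoIsolated G)
    (G-sym : ∀ {u v} → Adj G u v → Adj G v u) (irrefl : ∀ {v} → ¬ Adj G v v)
    {P : List (V G)} (γ : IsγtValue G (length P)) where
  open Finite fin
  open DecMembership _≟_ using (_∈?_)

  ListBump : ℕ → Set
  ListBump k = ∃ λ F → IsEdgeSet G F × length F ≡ k × γtIncreases G (subdivide G F)

  EdgeBump : ℕ → Set
  EdgeBump t = ∃ λ u → ∃ λ v → Adj G u v × γtIncreases G (subdivideEdge G u v t)

  private
    plus-new : {X : Set} → length P < suc (length (map (inj₁ {B = X}) P))
    plus-new = s≤s (≤-reflexive (sym (length-map inj₁ P)))

    list-bump : ∀ F {P′ : List (V (subdivide G F))} → IsPacking (subdivide G F) P′ → length P < length P′ →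
      γtIncreases G (subdivide G F)
    list-bump F = bump γ (subdivide-finite fin F) (subdivide-noIso fin noIso F)

    edge-bump : ∀ u v t {P′ : List (V (subdivideEdge G u v (suc t)))} →
      IsPacking (subdivideEdge G u v (suc t)) P′ → length P < length P′ →
      γtIncreases G (subdivideEdge G u v (suc t))
    edge-bump u v t = bump γ (subdivideEdge-finite fin u v (suc t)) (subdivideEdge-noIso fin noIso u v t)

    adj-≢ : ∀ {u v} → Adj G u v → u ≢ v
    adj-≢ uv refl = irrefl uv

    ¬same : ∀ {a b c d : V G} → a ≢ c ⊎ b ≢ d → a ≢ d ⊎ b ≢ c → ¬ SameEdge (a , b) (c , d)
    ¬same (inj₁ a≢c) _ (inj₁ (a≡c , _)) = a≢c a≡c
    ¬same (inj₂ b≢d) _ (inj₁ (_ , b≡d)) = b≢d b≡d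
    ¬same _ (inj₁ a≢d) (inj₂ (a≡d , _)) = a≢d a≡d
    ¬same _ (inj₂ b≢c) (inj₂ (_ , b≡c)) = b≢c b≡c

  module _ (packing : IsPacking G P) where
    private
      sep : ∀ {p q z} → p ∈ P → q ∈ P → Adj G p z → Adj G q z → p ≡ q
      sep = proj₂ packing

    -- No member of `P` is adjacent to `v`, and its neighbour `u` is not in `P`, so the new vertex
    -- next to `v` can join.
    undominated-edge : ∀ {v} → ¬ (∃ λ p → p ∈ P × Adj G v p) → EdgeBump 2
    undominated-edge {v} undom with noIso v
    ... | u , vu = v , u , vu , edge-bump v u 1
      (subdivideEdge-packing-new (proj₁ packing) v u 0 (λ p∈ q∈ pz qz _ _ → sep p∈ q∈ pz qz)
        (λ p∈P pv → ⊥-elim (undom (_ , p∈P , G-sym pv))) (inj₁ λ u∈P → undom (u , u∈P , vu)))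
      plus-new

    -- The new vertex on `uv` is blocked only by a member `w` of `P` at `u` other than `v`; without
    -- one, a single subdivision would already suffice. There is at most one such `w`, and
    -- subdividing `uw` removes it.
    undominated-list : (∀ {u v} → Adj G u v → ¬ γtIncreases G (subdivide G [ u , v ])) →
      ∀ {v} → ¬ (∃ λ p → p ∈ P × Adj G v p) → ListBump 2
    undominated-list no-single {v} undom with noIso v
    ... | u , vu = choose (dominated? fin P u)
      where
      v-undom : ∀ {A : Set} {p} → p ∈ P → Adj G p v → A
      v-undom p∈P pv = ⊥-elim (undom (_ , p∈P , G-sym pv))
      u∉P : u ∉ P
      u∉P u∈P = undom (u , u∈P , vu)
      single : (∀ {p} → p ∈ P → Adj G p u → p ≡ v) → ⊥
      single only-v = no-single (G-sym vu) (list-bump [ u , v ]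
        (subdivide-packing-new (proj₁ packing) _ (λ p∈ q∈ pz qz _ _ → sep p∈ q∈ pz qz)
          ((λ (u∈P , _) → u∉P u∈P) ∷ []) zero
          (λ p∈P pu → here (inj₂ (only-v p∈P pu , refl))) v-undom)
        plus-new)
      choose : Dec (∃ λ p → p ∈ P × Adj G u p) → ListBump 2
      choose (no u-undom) = ⊥-elim (single λ p∈P pu → ⊥-elim (u-undom (_ , p∈P , G-sym pu)))
      choose (yes (w , w∈P , uw)) with w ≟ v
      ... | yes refl = ⊥-elim (single λ p∈P pu → sep p∈P w∈P pu (G-sym uw))
      ... | no w≢v = (u , v) ∷ (u , w) ∷ [] ,
        (G-sym vu ∷ uw ∷ [] , (¬same (inj₂ (w≢v ∘ sym)) (inj₁ (adj-≢ uw)) ∷ []) ∷ [] ∷ []) , refl ,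
        list-bump _
          (subdivide-packing-new (proj₁ packing) _ (λ p∈ q∈ pz qz _ _ → sep p∈ q∈ pz qz)
            ((λ (u∈P , _) → u∉P u∈P) ∷ (λ (u∈P , _) → u∉P u∈P) ∷ []) zero
            (λ p∈P pu → there (here (inj₂ (sep p∈P w∈P pu (G-sym uw) , refl)))) v-undom)
          plus-new

    module _ {c b a : V G} (c∉P : c ∉ P) (leaf : ∀ {w} → Adj G c w → w ≡ b)
        (cb : Adj G c b) (b∈P : b ∈ P) (ba : Adj G b a) (a∈P : a ∈ P) where

      -- The only neighbour of `c` becomes a new vertex whose other neighbour is new too, so `c`
      -- itself joins `P`.
      leaf-edge : EdgeBump 2
      leaf-edge = c , b , cb , edge-bump c b 1
        (subdivideEdge-packing (All.tabulate (λ { p∈P refl → c∉P p∈P }) ∷ proj₁ packing) c b 0 sep′)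
        plus-new
        where
        sep′ : ∀ {p q z} → p ∈ c ∷ P → q ∈ c ∷ P → Adj G p z → Adj G q z →
          ¬ SameEdge (p , z) (c , b) → ¬ SameEdge (q , z) (c , b) → p ≡ q
        sep′ (here refl) (here refl) _ _ _ _ = refl
        sep′ (here refl) (there _) cz _ uncut _ = ⊥-elim (uncut (inj₁ (refl , leaf cz)))
        sep′ (there _) (here refl) _ cz _ uncut = ⊥-elim (uncut (inj₁ (refl , leaf cz)))
        sep′ (there p∈) (there q∈) pz qz _ _ = sep p∈ q∈ pz qz

      -- b is exchanged for c and the new vertex on ba.
      leaf-list : ListBump 2
      leaf-list with extract (proj₁ packing) b∈P
      ... | P₀ , unique₀ , len , sub = F ,
        (ba ∷ cb ∷ [] , (¬same (inj₁ (adj-≢ (G-sym cb))) (inj₂ a≢c) ∷ []) ∷ [] ∷ []) , refl ,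
        list-bump F
          (subdivide-packing-new (All.tabulate (λ { p∈ refl → c∉P (P₀⊆P p∈) }) ∷ unique₀) F sep′
            ((λ (b∈ , _) → b∉ b∈) ∷ (λ (_ , b∈) → b∉ b∈) ∷ []) zero cut-b cut-a)
          (≤-reflexive (cong suc (trans len (cong suc (sym (length-map inj₁ P₀))))))
        where
        F = (b , a) ∷ (c , b) ∷ []
        P₀⊆P : ∀ {p} → p ∈ P₀ → p ∈ P
        P₀⊆P p∈ = proj₁ (sub p∈)
        a≢c : a ≢ c
        a≢c refl = c∉P a∈P
        b∉ : b ∉ c ∷ P₀
        b∉ (here refl) = c∉P b∈P
        b∉ (there b∈) = proj₂ (sub b∈) refl
        sep′ : ∀ {p q z} → p ∈ c ∷ P₀ → q ∈ c ∷ P₀ → Adj G p z → Adj G q z →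
          ¬ Any (SameEdge (p , z)) F → ¬ Any (SameEdge (q , z)) F → p ≡ q
        sep′ (here refl) (here refl) _ _ _ _ = refl
        sep′ (here refl) (there _) cz _ uncut _ = ⊥-elim (uncut (there (here (inj₁ (refl , leaf cz)))))
        sep′ (there _) (here refl) _ cz _ uncut = ⊥-elim (uncut (there (here (inj₁ (refl , leaf cz)))))
        sep′ (there p∈) (there q∈) pz qz _ _ = sep (P₀⊆P p∈) (P₀⊆P q∈) pz qz
        -- Among the members only `c` and `a` can be adjacent to `b`, each along an edge of `F`; `a`
        -- has lost `b`, its only neighbour in `P`.
        cut-b : ∀ {p} → p ∈ c ∷ P₀ → Adj G p b → Any (SameEdge (p , b)) F
        cut-b (here refl) _ = there (here (inj₁ (refl , refl)))
        cut-b (there p∈) pb = here (inj₂ (sep (P₀⊆P p∈) a∈P pb (G-sym ba) , refl))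
        cut-a : ∀ {p} → p ∈ c ∷ P₀ → Adj G p a → Any (SameEdge (p , a)) F
        cut-a (here refl) pa = ⊥-elim (irrefl (subst (Adj G b) (leaf pa) ba))
        cut-a (there p∈) pa = ⊥-elim (proj₂ (sub p∈) (sep (P₀⊆P p∈) b∈P pa ba))

    perfect-or-bumps : (∀ {u v} → Adj G u v → ¬ γtIncreases G (subdivide G [ u , v ])) →
      Perfect G P ⊎ ListBump 2 × EdgeBump 2
    perfect-or-bumps no-single with findVertex fin (λ v → ¬? (dominated? fin P v))
    ... | yes (v , undom) = inj₂ (undominated-list no-single undom , undominated-edge undom)
    ... | no all-dominated = leafy (findVertex fin leaf?)
      where
      dom : ∀ v → ∃ λ p → p ∈ P × Adj G v p
      dom v = decidable-stable (dominated? fin P v) λ undom → all-dominated (v , undom)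
      π : V G → V G
      π = proj₁ ∘ dom
      leaf? : ∀ v → Dec (v ∉ P × ¬ (∃ λ w → Adj G v w × w ≢ π v))
      leaf? v = ¬? (v ∈? P) ×-dec ¬? (findVertex fin λ w → adj? v w ×-dec ¬? (w ≟ π v))
      leafy : Dec (∃ λ v → v ∉ P × ¬ (∃ λ w → Adj G v w × w ≢ π v)) →
        Perfect G P ⊎ ListBump 2 × EdgeBump 2
      leafy (no no-leaf) = inj₁ (record
        { packing = packing ; π = π ; π∈P = proj₁ ∘ proj₂ ∘ dom ; π-adj = proj₂ ∘ proj₂ ∘ dom
        ; nonleaf = λ {v} v∉P → decidable-stable (findVertex fin λ w → adj? v w ×-dec ¬? (w ≟ π v))
            λ leaf → no-leaf (v , v∉P , leaf) })
      -- The leaf `c` hangs on `π c`, and the partner `π (π c)` serves as `a`.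
      leafy (yes (c , c∉P , leaf)) = inj₂ (
        leaf-list c∉P only (π-adj c) (π∈P c) (π-adj (π c)) (π∈P (π c)) ,
        leaf-edge c∉P only (π-adj c) (π∈P c) (π-adj (π c)) (π∈P (π c)))
        where
        π∈P = proj₁ ∘ proj₂ ∘ dom
        π-adj = proj₂ ∘ proj₂ ∘ dom
        only : ∀ {w} → Adj G c w → w ≡ π c
        only {w} cw = decidable-stable (w ≟ π c) λ w≢ → leaf (w , cw , w≢)

  module _ (perfect : Perfect G P) where
    open Perfect perfect

    -- The edge is a pair of `P`, so `c` is the only member of `P` at `b`, along the cut edge. A
    -- third new vertex keeps the second one away from `c`.
    perfect-edge : V G → EdgeBump 3
    perfect-edge v = b , c , π-adj b , edge-bump b c 2
      (subdivideEdge-packing-new (proj₁ packing) b c 1 (λ p∈ q∈ pz qz _ _ → proj₂ packing p∈ q∈ pz qz)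
        (λ p∈P pb → sym (π-unique G-sym p∈P (G-sym pb))) (inj₂ ≤-refl))
      plus-new
      where
      b = π v
      c = π b

    -- Inside `P` a walk can only alternate between `p` and `π p`, so a walk to any other vertex
    -- leaves `P`.
    leave-pair : ∀ {p z} → Walk G p z → p ∈ P → z ≢ p → z ≢ π p → ∃ λ a → a ∉ P
    leave-pair here _ z≢p _ = ⊥-elim (z≢p refl)
    leave-pair {p} (step {w = w} pw walk) p∈P z≢p z≢πp with w ∈? P
    ... | no w∉P = w , w∉P
    ... | yes w∈P = leave-pair walk w∈P
      (λ z≡w → z≢πp (trans z≡w (sym (π-unique G-sym w∈P pw))))
      (λ z≡πw → z≢p (trans z≡πw (π-unique G-sym p∈P (G-sym pw))))

    -- Since `π a` is the only neighbour of `a` in `P`, `a′` is outside `P` as well. Cutting the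
    -- edges to `π a` and `π a′` lets the new vertex on `aa′` join.
    perfect-list : ∀ {a} → a ∉ P → ListBump 3
    perfect-list {a} a∉P with nonleaf a∉P
    ... | a′ , aa′ , a′≢πa = F ,
      ( aa′ ∷ π-adj a ∷ π-adj a′ ∷ []
      , (¬same (inj₂ a′≢πa) (inj₁ (adj-≢ (π-adj a)))
          ∷ ¬same (inj₁ (adj-≢ aa′)) (inj₁ (a∉ (π∈P a′))) ∷ [])
        ∷ (¬same (inj₁ (adj-≢ aa′)) (inj₁ (a∉ (π∈P a′))) ∷ []) ∷ [] ∷ []) , refl ,
      list-bump F
        (subdivide-packing-new (proj₁ packing) F (λ p∈ q∈ pz qz _ _ → proj₂ packing p∈ q∈ pz qz)
          ((λ (a∈ , _) → a∉P a∈) ∷ (λ (a∈ , _) → a∉P a∈) ∷ (λ (a′∈ , _) → a′∉P a′∈) ∷ []) zero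
          (λ p∈P pa → there (here (inj₂ (sym (π-unique G-sym p∈P (G-sym pa)) , refl))))
          (λ p∈P pa′ → there (there (here (inj₂ (sym (π-unique G-sym p∈P (G-sym pa′)) , refl))))))
        plus-new
      where
      F = (a , a′) ∷ (a , π a) ∷ (a′ , π a′) ∷ []
      a∉ : ∀ {q} → q ∈ P → a ≢ q
      a∉ q∈P refl = a∉P q∈P
      a′∉P : a′ ∉ P
      a′∉P a′∈P = a′≢πa (sym (π-unique G-sym a′∈P aa′))

-- Upper bounds: shifting a perfect packing towards the subdivided edges

-- G′ is G with new vertices on some edges; up points from every vertex outside the middle part
-- towards that part, and new v is the first vertex after v on the subdivided edge from v to up v.
-- When one edge is subdivided twice, all vertices are outer and its ends point to each other.
record Directed (G G′ : Graph) : Set₁ where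
  field
    ι         : V G → V G′
    Outer     : V G → Set
    outer?    : ∀ v → Dec (Outer v)
    up        : V G → V G
    Crossing  : V G → Set
    crossing? : ∀ v → Dec (Crossing v)
    new       : V G → V G′
    inner     : ∀ {v} → Outer v → ¬ Crossing v →
      Adj G′ (ι v) (ι (up v)) × Adj G′ (ι (up v)) (ι v) × Outer (up v) × up (up v) ≢ v
    down      : ∀ {v w} → Outer v → Adj G w v → w ≢ up v → Outer w × up w ≡ v × ¬ Crossing w
    crossing  : ∀ {v} → Outer v → Crossing v → Adj G′ (ι v) (new v)
    middle    : ∀ {v w} → ¬ Outer v → ¬ Outer w → Adj G v w → Adj G′ (ι v) (ι w)
    entry     : ∀ {v w} → ¬ Outer v → Outer w → Adj G v w →
      up w ≡ v × Crossing w × Adj G′ (ι v) (new w)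
    cover     : ∀ v′ → (∃ λ v → v′ ≡ ι v) ⊎ (∃ λ s → v′ ≡ new s × Outer s × Crossing s × Adj G′ (new s) (ι s) ×
      (¬ Outer (up s) × Adj G′ (new s) (ι (up s)) ⊎
       Outer (up s) × Crossing (up s) × Adj G′ (new s) (new (up s))))

module Shift {G G′ : Graph} (fin : Finite G) (G-sym : ∀ {u v} → Adj G u v → Adj G v u)
    {P : List (V G)} (perfect : Perfect G P) (directed : Directed G G′) where
  open Finite fin
  open Perfect perfect
  open Directed directed
  open DecMembership _≟_ using (_∈?_)

  private
    ππ : ∀ {v} → v ∈ P → π (π v) ≡ v
    ππ v∈P = π-unique G-sym v∈P (G-sym (π-adj _))

  above : V G → V G′
  above v with crossing? v
  ... | yes _ = new v
  ... | no _ = ι (up v)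

  above-new : ∀ {v} → Crossing v → above v ≡ new v
  above-new {v} c with crossing? v
  ... | yes _ = refl
  ... | no ¬c = ⊥-elim (¬c c)

  above-up : ∀ {v} → ¬ Crossing v → above v ≡ ι (up v)
  above-up {v} ¬c with crossing? v
  ... | yes c = ⊥-elim (¬c c)
  ... | no _ = refl

  -- In a pair {b, c} of outer vertices with c below b, the vertex c moves to the place above b.
  shift : V G → V G′
  shift d with outer? d | π d ≟ up d | crossing? d
  ... | no _  | _     | _     = ι d
  ... | yes _ | no _  | _     = ι d
  -- The edge inside the pair is itself subdivided. If it is subdivided twice, its ends point to
  -- each other and both move inwards.
  ... | yes _ | yes _ | yes _ = new d
  ... | yes _ | yes _ | no _  = above (up d)

  shift-middle : ∀ {d} → ¬ Outer d → shift d ≡ ι d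
  shift-middle {d} ¬o with outer? d | π d ≟ up d | crossing? d
  ... | no _  | _     | _     = refl
  ... | yes o | _     | _     = ⊥-elim (¬o o)

  shift-top : ∀ {d} → π d ≢ up d → shift d ≡ ι d
  shift-top {d} top with outer? d | π d ≟ up d | crossing? d
  ... | no _  | _      | _ = refl
  ... | yes _ | no _   | _ = refl
  ... | yes _ | yes eq | _ = ⊥-elim (top eq)

  shift-crossing : ∀ {d} → Outer d → π d ≡ up d → Crossing d → shift d ≡ new d
  shift-crossing {d} o low c with outer? d | π d ≟ up d | crossing? d
  ... | no ¬o | _      | _     = ⊥-elim (¬o o)
  ... | yes _ | no top | _     = ⊥-elim (top low)
  ... | yes _ | yes _  | yes _ = refl
  ... | yes _ | yes _  | no ¬c = ⊥-elim (¬c c)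

  shift-low : ∀ {d} → Outer d → π d ≡ up d → ¬ Crossing d → shift d ≡ above (up d)
  shift-low {d} o low ¬c with outer? d | π d ≟ up d | crossing? d
  ... | no ¬o | _      | _     = ⊥-elim (¬o o)
  ... | yes _ | no top | _     = ⊥-elim (top low)
  ... | yes _ | yes _  | yes c = ⊥-elim (¬c c)
  ... | yes _ | yes _  | no _  = refl

  Shifted : V G′ → Set
  Shifted y = ∃ λ d → d ∈ P × shift d ≡ y

  above-adj : ∀ {v} → Outer v → Adj G′ (ι v) (above v)
  above-adj {v} o with crossing? v
  ... | yes c = crossing o c
  ... | no ¬c = proj₁ (inner o ¬c)

  -- `π v` is a child of `v`, and it is the vertex that moves there.
  above-shifted : ∀ {v} → v ∈ P → Outer v → π v ≢ up v → Shifted (above v)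
  above-shifted {v} v∈P o top with down o (G-sym (π-adj v)) top
  ... | o′ , up≡ , ¬c =
    π v , π∈P v , trans (shift-low o′ (trans (ππ v∈P) (sym up≡)) ¬c) (cong above up≡)

  -- `π v` is a child of `v` and the upper member of its pair, since `v` is not in `P`; its partner
  -- moves to `v`.
  self-shifted : ∀ {v} → v ∉ P → Outer v → π v ≢ up v → Shifted (ι v)
  self-shifted {v} v∉P o top with down o (G-sym (π-adj v)) top
  ... | o′ , up≡ , ¬c = subst Shifted (trans (above-up ¬c) (cong ι up≡))
    (above-shifted (π∈P v) o′ λ eq → v∉P (subst (_∈ P) (trans eq up≡) (π∈P (π v))))

  new-shifted : ∀ {s} → s ∈ P → Outer s → Crossing s → Shifted (new s)
  new-shifted {s} s∈P o c with π s ≟ up s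
  ... | yes low = s , s∈P , shift-crossing o low c
  ... | no top = subst Shifted (above-new c) (above-shifted s∈P o top)

  Dominated : V G′ → Set
  Dominated v′ = ∃ λ y → Shifted y × Adj G′ v′ y

  -- If `π v` is outer, the edge to it is subdivided and the new vertex there is occupied.
  old-middle : ∀ {v} → ¬ Outer v → Dominated (ι v)
  old-middle {v} ¬o with outer? (π v)
  ... | no ¬o′ = ι (π v) , (π v , π∈P v , shift-middle ¬o′) , middle ¬o ¬o′ (π-adj v)
  ... | yes o′ with entry ¬o o′ (π-adj v)
  ... | _ , c , adj = new (π v) , new-shifted (π∈P v) o′ c , adj

  old-outer : ∀ {v} → Outer v → Dominated (ι v)
  old-outer {v} o with π v ≟ up v | v ∈? P
  ... | no top | yes v∈P = above v , above-shifted v∈P o top , above-adj o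
  ... | no top | no v∉P with down o (G-sym (π-adj v)) top
  ...   | o′ , up≡ , ¬c = ι (π v)
        , (π v , π∈P v , shift-top λ eq → v∉P (subst (_∈ P) (trans eq up≡) (π∈P (π v))))
        , subst (λ z → Adj G′ (ι z) (ι (π v))) up≡ (proj₁ (proj₂ (inner o′ ¬c)))
  old-outer {v} o | yes low | yes v∈P with crossing? v
  ...   | yes c = new v , (v , v∈P , shift-crossing o low c) , crossing o c
  ...   | no ¬c with inner o ¬c
  -- `up v` is the upper member of its pair with `v` and stays, because `up (up v)` differs from
  -- `v`.
  ...     | adj , _ , _ , upup≢ = ι (up v)
          , (up v , subst (_∈ P) low (π∈P v) , shift-top λ eq →
              upup≢ (trans (sym eq) (trans (cong π (sym low)) (ππ v∈P))))
          , adj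
  -- The member `up v` may move away. The second neighbour `w` is a child of `v` outside `P` whose
  -- own dominator is below it, so a vertex moves to `w`.
  old-outer {v} o | yes low | no v∉P with nonleaf v∉P
  ...   | w , vw , w≢ with down o (G-sym vw) (λ eq → w≢ (trans eq (sym low)))
  ...     | o′ , up≡ , ¬c = ι w
          , self-shifted (λ w∈P → w≢ (sym (π-unique G-sym w∈P vw))) o′
              (λ eq → v∉P (subst (_∈ P) (trans eq up≡) (π∈P w)))
          , subst (λ z → Adj G′ (ι z) (ι w)) up≡ (proj₁ (proj₂ (inner o′ ¬c)))

  dominated : ∀ v′ → Dominated v′
  dominated v′ with cover v′
  ... | inj₁ (v , refl) with outer? v
  ...   | yes o = old-outer o
  ...   | no ¬o = old-middle ¬o
  dominated v′ | inj₂ (s , refl , o , c , new-s , far) = beyond (up s ∈? P) far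
    where
    -- With `up s` outside `P`, either `s` is an upper member and stays, or the pair of its child
    -- `π s` moves up to `s`.
    own : up s ∉ P → Shifted (ι s)
    own up∉P with s ∈? P
    ... | yes s∈P = s , s∈P , shift-top λ eq → up∉P (subst (_∈ P) eq (π∈P s))
    ... | no s∉P = self-shifted s∉P o λ eq → up∉P (subst (_∈ P) eq (π∈P s))
    beyond : Dec (up s ∈ P) → ¬ Outer (up s) × Adj G′ (new s) (ι (up s)) ⊎
      Outer (up s) × Crossing (up s) × Adj G′ (new s) (new (up s)) → Dominated (new s)
    beyond (no up∉P) _ = ι s , own up∉P , new-s
    beyond (yes up∈P) (inj₁ (¬o , adj)) = ι (up s) , (up s , up∈P , shift-middle ¬o) , adj
    beyond (yes up∈P) (inj₂ (o′ , c′ , adj)) = new (up s) , new-shifted up∈P o′ c′ , adj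

  shift-no-bump : IsγtValue G (length P) → Finite G′ → ¬ γtIncreases G G′
  shift-no-bump γ fin′ = no-bump γ fin′ (map shift P) all-dominated (≤-reflexive (length-map shift P))
    where
    all-dominated : ∀ v′ → ∃ λ u → u ∈ map shift P × Adj G′ v′ u
    all-dominated v′ with dominated v′
    ... | y , (d , d∈P , refl) , adj = shift d , ∈-map⁺ shift d∈P , adj

-- Unordered edges, descendants and change of root

SameEdge-sym : {A : Set} {e f : A × A} → SameEdge e f → SameEdge f e
SameEdge-sym (inj₁ (refl , refl)) = inj₁ (refl , refl)
SameEdge-sym (inj₂ (refl , refl)) = inj₂ (refl , refl)

SameEdge-join : {A : Set} {e f g : A × A} → SameEdge e g → SameEdge f g → SameEdge e f
SameEdge-join (inj₁ (refl , refl)) (inj₁ (refl , refl)) = inj₁ (refl , refl)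
SameEdge-join (inj₁ (refl , refl)) (inj₂ (refl , refl)) = inj₂ (refl , refl)
SameEdge-join (inj₂ (refl , refl)) (inj₁ (refl , refl)) = inj₂ (refl , refl)
SameEdge-join (inj₂ (refl , refl)) (inj₂ (refl , refl)) = inj₁ (refl , refl)

module Descendants {G : Graph} (fin : Finite G) {r : V G} (R : Rooting G r) where
  open Finite fin
  open Rooting R

  data Below (s : V G) : V G → Set where
    self  : Below s s
    climb : ∀ {v} → v ≢ r → Below s (up v) → Below s v

  below-dep : ∀ {s v} → Below s v → dep s ≤ dep v
  below-dep self = ≤-refl
  below-dep (climb v≢r b) = ≤-trans (below-dep b) (<⇒≤ (up-dep v≢r))

  ¬below-up : ∀ {s} → s ≢ r → ¬ Below s (up s)
  ¬below-up s≢r b = <-irrefl refl (<-≤-trans (up-dep s≢r) (below-dep b))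

  below-step : ∀ {s v} → Below s v → s ≡ v ⊎ Below s (up v)
  below-step self        = inj₁ refl
  below-step (climb _ b) = inj₂ b

  below-root : ∀ {s} → Below s r → s ≡ r
  below-root self = refl
  below-root (climb r≢r _) = ⊥-elim (r≢r refl)

  below? : ∀ s v → Dec (Below s v)
  below? s v = go v (<-wellFounded (dep v))
    where
    go : ∀ v → Acc _<_ (dep v) → Dec (Below s v)
    go v (acc rec) with s ≟ v | v ≟ r
    ... | yes refl | _ = yes self
    ... | no s≢v | yes refl = no (s≢v ∘ below-root)
    ... | no s≢v | no v≢r with go (up v) (rec (up-dep v≢r))
    ...   | yes b = yes (climb v≢r b)
    ...   | no ¬b = no λ { self → s≢v refl ; (climb _ b) → ¬b b }

  up-up : ∀ {v} → v ≢ r → up v ≢ r → up (up v) ≢ v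
  up-up v≢r upv≢r eq = <-irrefl (cong dep eq) (<-trans (up-dep upv≢r) (up-dep v≢r))

module Reroot {G : Graph} (fin : Finite G) {r : V G} (R : Rooting G r)
    {s : V G} (s≢r : s ≢ r) (up-s : Rooting.up R s ≡ r) (rs : Adj G r s) where
  open Finite fin
  open Rooting R
  open Descendants fin R

  -- Only the edge `rs` is turned around.
  up′ : V G → V G
  up′ v with v ≟ r
  ... | yes _ = s
  ... | no _  = up v

  -- The offset makes r deeper than s.
  dep′ : V G → ℕ
  dep′ v with below? s v
  ... | yes _ = dep v
  ... | no _  = suc (dep s) + dep v

  dep′-below : ∀ {v} → Below s v → dep′ v ≡ dep v
  dep′-below {v} b with below? s v
  ... | yes _ = refl
  ... | no ¬b = ⊥-elim (¬b b)

  dep′-above : ∀ {v} → ¬ Below s v → dep′ v ≡ suc (dep s) + dep v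
  dep′-above {v} ¬b with below? s v
  ... | yes b = ⊥-elim (¬b b)
  ... | no _  = refl

  up′-root : up′ r ≡ s
  up′-root with r ≟ r
  ... | yes _  = refl
  ... | no r≢r = ⊥-elim (r≢r refl)

  up′-other : ∀ {v} → v ≢ r → up′ v ≡ up v
  up′-other {v} v≢r with v ≟ r
  ... | yes v≡r = ⊥-elim (v≢r v≡r)
  ... | no _    = refl

  rerooted : Rooting G s
  rerooted = record { up = up′ ; dep = dep′ ; up-adj = up′-adj ; up-dep = up′-dep ; orient = orient′ }
    where
    up′-adj : ∀ {v} → v ≢ s → Adj G v (up′ v)
    up′-adj {v} v≢s with v ≟ r
    ... | yes refl = rs
    ... | no v≢r = up-adj v≢r

    up′-dep : ∀ {v} → v ≢ s → dep′ (up′ v) < dep′ v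
    up′-dep {v} v≢s = split (v ≟ r)
      where
      -- A parent edge leaves the subtree below `s` only at `s`, so here both depths carry the same
      -- offset.
      nonroot : v ≢ r → Dec (Below s (up v)) → Dec (Below s v) → dep′ (up v) < dep′ v
      nonroot v≢r (yes b) _ rewrite dep′-below b | dep′-below (climb v≢r b) = up-dep v≢r
      nonroot v≢r (no ¬b) (yes self) = ⊥-elim (v≢s refl)
      nonroot v≢r (no ¬b) (yes (climb _ b)) = ⊥-elim (¬b b)
      nonroot v≢r (no ¬b) (no ¬b′) rewrite dep′-above ¬b | dep′-above ¬b′ =
        +-monoʳ-< (suc (dep s)) (up-dep v≢r)
      split : Dec (v ≡ r) → dep′ (up′ v) < dep′ v
      split (yes refl) rewrite up′-root | dep′-below self | dep′-above (s≢r ∘ below-root) =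
        s≤s (m≤m+n (dep s) (dep r))
      split (no v≢r) rewrite up′-other v≢r = nonroot v≢r (below? s (up v)) (below? s v)

    turn : ∀ {u v} → u ≢ r → up u ≡ v → (u ≢ s × up′ u ≡ v) ⊎ (v ≢ s × up′ v ≡ u)
    turn {u} u≢r upu≡v with u ≟ s
    ... | no u≢s = inj₁ (u≢s , trans (up′-other u≢r) upu≡v)
    ... | yes refl with trans (sym up-s) upu≡v
    ... | refl = inj₂ (s≢r ∘ sym , up′-root)

    orient′ : ∀ {u v} → Adj G u v → (u ≢ s × up′ u ≡ v) ⊎ (v ≢ s × up′ v ≡ u)
    orient′ uv with orient uv
    ... | inj₁ (u≢r , eq) = turn u≢r eq
    ... | inj₂ (v≢r , eq) = swap (turn v≢r eq)

  -- Climbing from `v`, both rootings agree until `s` is reached, and the new one ends there, before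
  -- `r`.
  below-disjoint : ∀ {v} → Below s v → ¬ Descendants.Below fin rerooted r v
  below-disjoint b Descendants.self = s≢r (below-root b)
  below-disjoint self (Descendants.climb s≢s _) = s≢s refl
  below-disjoint (climb v≢r b) (Descendants.climb _ b′) =
    below-disjoint b (subst (Descendants.Below fin rerooted r) (up′-other v≢r) b′)

-- Directing a tree towards its subdivided edges

module _ {G : Graph} (fin : Finite G) (G-sym : ∀ {u v} → Adj G u v → Adj G v u) where
  open Finite fin

  -- No edge of `F` lies below another. Cutting `F` therefore leaves a middle part around the root
  -- and, under each edge, a subtree in which `up` points to that edge.
  record Antichain (F : List (V G × V G)) : Set where
    field
      {root}    : V G
      rooting   : Rooting G root
    open Rooting rooting
    open Descendants fin rooting
    field
      bottom    : Fin (length F) → V G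
      nonroot   : ∀ i → bottom i ≢ root
      edge      : ∀ i → SameEdge (bottom i , up (bottom i)) (lookup F i)
      antichain : ∀ i j → Below (bottom i) (bottom j) → i ≡ j

  directed-list : ∀ {F} → Antichain F → Directed G (subdivide G F)
  directed-list {F} A = record
    { ι = inj₁ ; Outer = Outer ; outer? = λ v → Fin.any? λ i → below? (bottom i) v
    ; up = up ; Crossing = Crossing ; crossing? = crossing? ; new = new
    ; inner = inner ; down = down ; crossing = λ { {v} _ c → new-below c }
    ; middle = λ ¬ov ¬ow vw → vw , ¬ov ∘ Outer-cut ¬ow
    ; entry = entry ; cover = cover }
    where
    open Antichain A
    open Rooting rooting
    open Descendants fin rooting
    G′ = subdivide G F

    Outer : V G → Set
    Outer v = ∃ λ i → Below (bottom i) v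

    Crossing : V G → Set
    Crossing v = ∃ λ i → bottom i ≡ v

    crossing? : ∀ v → Dec (Crossing v)
    crossing? v = Fin.any? λ i → bottom i ≟ v

    new : V G → V G′
    new v with crossing? v
    ... | yes (i , _) = inj₂ i
    ... | no _ = inj₁ v

    new-bottom : ∀ i → new (bottom i) ≡ inj₂ i
    new-bottom i with crossing? (bottom i)
    -- The search may return an index other than `i`; equal bottoms are comparable, which identifies
    -- the two.
    ... | yes (j , eq) = cong inj₂ (antichain j i (subst (Below (bottom j)) eq self))
    ... | no ¬c = ⊥-elim (¬c (i , refl))

    ends₁ : ∀ {a b e} → SameEdge (a , b) e → a ≡ proj₁ e ⊎ a ≡ proj₂ e
    ends₁ (inj₁ (p , _)) = inj₁ p
    ends₁ (inj₂ (p , _)) = inj₂ p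

    bottom-end : ∀ i → Adj G′ (inj₁ (bottom i)) (inj₂ i)
    bottom-end i = ends₁ (edge i)

    top-end : ∀ i → Adj G′ (inj₁ (up (bottom i))) (inj₂ i)
    top-end i = ends₁ (SameEdge-swap {a = bottom i} (edge i))

    new-below : ∀ {v} → Crossing v → Adj G′ (inj₁ v) (new v)
    new-below (i , refl) = subst (Adj G′ (inj₁ (bottom i))) (sym (new-bottom i)) (bottom-end i)

    outer-nonroot : ∀ {v} → Outer v → v ≢ root
    outer-nonroot (i , b) refl = nonroot i (below-root b)

    outer-up : ∀ {v} → Outer v → ¬ Crossing v → Outer (up v)
    outer-up (i , self) ¬c = ⊥-elim (¬c (i , refl))
    outer-up (i , climb _ b) _ = i , b

    cut-bottom : ∀ {a b} → Any (SameEdge (a , b)) F → ∃ λ i → SameEdge (a , b) (bottom i , up (bottom i))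
    cut-bottom cut = index cut , SameEdge-join (AnyP.lookup-index cut) (edge (index cut))

    Outer-cut : ∀ {a b} → ¬ Outer b → Any (SameEdge (a , b)) F → Outer a
    Outer-cut ¬ob cut with cut-bottom cut
    ... | i , inj₁ (refl , _) = i , self
    ... | i , inj₂ (_ , refl) = ⊥-elim (¬ob (i , self))

    uncut : ∀ {v} → Outer v → ¬ Crossing v → ¬ Any (SameEdge (v , up v)) F
    uncut o ¬c cut with cut-bottom cut
    ... | i , inj₁ (eq , _) = ¬c (i , sym eq)
    -- Read backwards, the cut edge would make `v` the parent of its own parent.
    ... | i , inj₂ (refl , eq) = up-up (nonroot i) (outer-nonroot o) eq

    inner : ∀ {v} → Outer v → ¬ Crossing v →
      Adj G′ (inj₁ v) (inj₁ (up v)) × Adj G′ (inj₁ (up v)) (inj₁ v) × Outer (up v) × up (up v) ≢ v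
    inner {v} o ¬c = (adj , uncut o ¬c) ,
      (G-sym adj , uncut o ¬c ∘ Any.map (λ {e} → SameEdge-swap {a = up v} {c = proj₁ e})) , o′ ,
      up-up (outer-nonroot o) (outer-nonroot o′)
      where
      adj = up-adj (outer-nonroot o)
      o′ = outer-up o ¬c

    down : ∀ {v w} → Outer v → Adj G w v → w ≢ up v → Outer w × up w ≡ v × ¬ Crossing w
    down {v} {w} (i , b) wv w≢ with orient wv
    ... | inj₂ (_ , eq) = ⊥-elim (w≢ (sym eq))
    ... | inj₁ (w≢r , refl) = (i , climb w≢r b) , refl , bad
      where
      bad : ¬ Crossing w
      bad (j , refl) with antichain i j (climb w≢r b)
      ... | refl = ¬below-up w≢r b

    entry : ∀ {v w} → ¬ Outer v → Outer w → Adj G v w → up w ≡ v × Crossing w × Adj G′ (inj₁ v) (new w)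
    entry {v} {w} ¬ov ow vw with orient vw
    ... | inj₁ (v≢r , refl) = ⊥-elim (¬ov (proj₁ ow , climb v≢r (proj₂ ow)))
    ... | inj₂ (_ , refl) with decidable-stable (crossing? w) (¬ov ∘ outer-up ow)
    ...   | i , refl = refl , (i , refl) , subst (Adj G′ (inj₁ (up w))) (sym (new-bottom i)) (top-end i)

    cover : ∀ v′ → (∃ λ v → v′ ≡ inj₁ v) ⊎ (∃ λ s → v′ ≡ new s × Outer s × Crossing s × Adj G′ (new s) (inj₁ s) ×
      (¬ Outer (up s) × Adj G′ (new s) (inj₁ (up s)) ⊎
       Outer (up s) × Crossing (up s) × Adj G′ (new s) (new (up s))))
    cover (inj₁ v) = inj₁ (v , refl)
    cover (inj₂ i) = inj₂ (bottom i , sym (new-bottom i) , (i , self) , (i , refl) ,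
      subst (λ x → Adj G′ x (inj₁ (bottom i))) (sym (new-bottom i)) (bottom-end i) ,
      inj₁ (¬outer , subst (λ x → Adj G′ x (inj₁ (up (bottom i)))) (sym (new-bottom i)) (top-end i)))
      where
      -- A bottom above `up (bottom i)` would also be above `bottom i`.
      ¬outer : ¬ Outer (up (bottom i))
      ¬outer (j , b) with antichain j i (climb (nonroot i) b)
      ... | refl = ¬below-up (nonroot i) b

  -- Rooted at `v`, every other vertex points towards `uv`. Turning `v` towards `u` makes the two
  -- ends face each other and leaves no middle part.
  directed-edge : ∀ {u v} → Rooting G v → Adj G u v → Directed G (subdivideEdge G u v 2)
  directed-edge {u} {v} R uv = record
    { ι = inj₁ ; Outer = λ _ → ⊤ ; outer? = λ _ → yes tt
    ; up = up′ ; Crossing = Crossing ; crossing? = λ w → w ≟ u ⊎-dec w ≟ v ; new = new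
    ; inner = λ _ → inner ; down = λ _ → down ; crossing = λ _ → new-below
    ; middle = λ ¬o → ⊥-elim (¬o tt) ; entry = λ ¬o → ⊥-elim (¬o tt) ; cover = cover }
    where
    open Rooting R
    open Descendants fin R
    G′ = subdivideEdge G u v 2

    Crossing : V G → Set
    Crossing w = w ≡ u ⊎ w ≡ v

    child : u ≢ v × up u ≡ v
    child with orient uv
    ... | inj₁ eq = eq
    ... | inj₂ (v≢v , _) = ⊥-elim (v≢v refl)
    u≢v = proj₁ child
    up-u = proj₂ child

    up′ : V G → V G
    up′ w with w ≟ v
    ... | yes _ = u
    ... | no _  = up w

    up′-root : up′ v ≡ u
    up′-root with v ≟ v
    ... | yes _  = refl
    ... | no v≢v = ⊥-elim (v≢v refl)

    up′-other : ∀ {w} → w ≢ v → up′ w ≡ up w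
    up′-other {w} w≢v with w ≟ v
    ... | yes w≡v = ⊥-elim (w≢v w≡v)
    ... | no _    = refl

    new : V G → V G′
    new w with w ≟ u
    ... | yes _ = inj₂ zero
    ... | no _  = inj₂ (suc zero)

    new-u : new u ≡ inj₂ zero
    new-u with u ≟ u
    ... | yes _  = refl
    ... | no u≢u = ⊥-elim (u≢u refl)

    new-v : new v ≡ inj₂ (suc zero)
    new-v with v ≟ u
    ... | yes v≡u = ⊥-elim (u≢v (sym v≡u))
    ... | no _    = refl

    new-below : ∀ {w} → Crossing w → Adj G′ (inj₁ w) (new w)
    new-below (inj₁ refl) rewrite new-u = inj₁ (refl , refl)
    new-below (inj₂ refl) rewrite new-v = inj₂ (refl , refl)

    inner : ∀ {w} → ¬ Crossing w →
      Adj G′ (inj₁ w) (inj₁ (up′ w)) × Adj G′ (inj₁ (up′ w)) (inj₁ w) × ⊤ × up′ (up′ w) ≢ w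
    inner {w} ¬c rewrite up′-other (¬c ∘ inj₂) =
      (up-adj w≢v , uncut) , (G-sym (up-adj w≢v) , uncut ∘ SameEdge-swap {a = up w}) , tt , back
      where
      w≢v : w ≢ v
      w≢v = ¬c ∘ inj₂
      uncut : ¬ SameEdge (w , up w) (u , v)
      uncut (inj₁ (w≡u , _)) = ¬c (inj₁ w≡u)
      uncut (inj₂ (w≡v , _)) = w≢v w≡v
      back : up′ (up w) ≢ w
      back eq with up w ≟ v
      ... | yes _ = ¬c (inj₁ (sym eq))
      ... | no upw≢v = up-up w≢v upw≢v eq

    down : ∀ {w x} → Adj G x w → x ≢ up′ w → ⊤ × up′ x ≡ w × ¬ Crossing x
    down {w} {x} xw x≢ with orient xw
    ... | inj₂ (w≢v , eq) = ⊥-elim (x≢ (sym (trans (up′-other w≢v) eq)))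
    ... | inj₁ (x≢v , refl) = tt , up′-other x≢v , bad
      where
      bad : ¬ Crossing x
      -- For `x` equal to `u`, the vertex `w` is `v`, and `x` is `up′ v`, which is excluded.
      bad (inj₁ refl) = x≢ (sym (trans (cong up′ up-u) up′-root))
      bad (inj₂ x≡v) = x≢v x≡v

    cover : ∀ v′ → (∃ λ w → v′ ≡ inj₁ w) ⊎ (∃ λ s → v′ ≡ new s × ⊤ × Crossing s × Adj G′ (new s) (inj₁ s) ×
      (¬ ⊤ × Adj G′ (new s) (inj₁ (up′ s)) ⊎ ⊤ × Crossing (up′ s) × Adj G′ (new s) (new (up′ s))))
    cover (inj₁ w) = inj₁ (w , refl)
    cover (inj₂ zero) = inj₂ (u , sym new-u , tt , inj₁ refl , u-end ,
      inj₂ (tt , inj₂ (trans (up′-other u≢v) up-u) , across))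
      where
      u-end : Adj G′ (new u) (inj₁ u)
      u-end rewrite new-u = inj₁ (refl , refl)
      across : Adj G′ (new u) (new (up′ u))
      across rewrite up′-other u≢v | up-u | new-u | new-v = inj₁ refl
    cover (inj₂ (suc zero)) = inj₂ (v , sym new-v , tt , inj₂ refl , v-end ,
      inj₂ (tt , inj₁ up′-root , across))
      where
      v-end : Adj G′ (new v) (inj₁ v)
      v-end rewrite new-v = inj₂ (refl , refl)
      across : Adj G′ (new v) (new (up′ v))
      across rewrite up′-root | new-u | new-v = inj₂ refl

  module _ (rootings : ∀ r → Rooting G r) where

    bottom-of : ∀ {r a b} (R : Rooting G r) → Adj G a b →
      ∃ λ u → u ≢ r × SameEdge (u , Rooting.up R u) (a , b)
    bottom-of {a = a} {b} R ab with Rooting.orient R ab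
    ... | inj₁ (a≢r , eq) = a , a≢r , inj₁ (refl , eq)
    ... | inj₂ (b≢r , eq) = b , b≢r , inj₂ (refl , eq)

    -- Rooted at an end of the second edge, or at its other end if the first edge lies below it,
    -- neither edge is above the other.
    antichain-pair : ∀ {a b c d} → Adj G a b → Adj G c d → ¬ SameEdge (a , b) (c , d) →
      Antichain ((a , b) ∷ (c , d) ∷ [])
    antichain-pair {a} {b} {c} {d} ab cd distinct = choose (below? c u)
      where
      R = rootings d
      open Rooting R
      open Descendants fin R
      u = proj₁ (bottom-of R ab)
      u≢d = proj₁ (proj₂ (bottom-of R ab))
      u-edge = proj₂ (proj₂ (bottom-of R ab))
      child : c ≢ d × up c ≡ d
      child with orient cd
      ... | inj₁ eq = eq
      ... | inj₂ (d≢d , _) = ⊥-elim (d≢d refl)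
      c≢d = proj₁ child
      up-c = proj₂ child
      u≢c : u ≢ c
      u≢c u≡c = distinct (SameEdge-join (SameEdge-sym {e = u , up u} {f = a , b} u-edge) (inj₁ (sym u≡c , sym (trans (cong up u≡c) up-c))))
      module R′ = Reroot fin R c≢d up-c (G-sym cd)
      choose : Dec (Below c u) → Antichain ((a , b) ∷ (c , d) ∷ [])
      choose (no ¬below) = record
        { rooting = R
        ; bottom = λ { zero → u ; (suc zero) → c }
        ; nonroot = λ { zero → u≢d ; (suc zero) → c≢d }
        ; edge = λ { zero → u-edge ; (suc zero) → inj₁ (refl , up-c) }
        ; antichain = λ { zero zero _ → refl
                        ; (suc zero) (suc zero) _ → refl
                        ; (suc zero) zero b → ⊥-elim (¬below b)
                        ; zero (suc zero) b → ⊥-elim ([ u≢c , u≢d ∘ below-root ∘ subst (Below u) up-c ]′ (below-step b)) } }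
      -- Rooted at `c`, the lower end of the second edge is `d`, and `u` lies on the side of `c`.
      choose (yes below) = record
        { rooting = R′.rerooted
        ; bottom = λ { zero → u ; (suc zero) → d }
        ; nonroot = λ { zero → u≢c ; (suc zero) → c≢d ∘ sym }
        ; edge = λ { zero → subst (λ x → SameEdge (u , x) (a , b)) (sym (R′.up′-other u≢d)) u-edge
                   ; (suc zero) → inj₂ (refl , R′.up′-root) }
        ; antichain = λ { zero zero _ → refl
                        ; (suc zero) (suc zero) _ → refl
                        ; (suc zero) zero b → ⊥-elim (R′.below-disjoint below b)
                        ; zero (suc zero) b →
                            ⊥-elim ([ u≢d , u≢c ∘ D′.below-root ∘ subst (D′.Below u) R′.up′-root ]′ (D′.below-step b)) } }
        where
        module D′ = Descendants fin R′.rerooted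

-- Comparing the two subdivision numbers

module Tree {G : Graph} (fin : Finite G) (noIso : NoIsolated G)
    (G-sym : ∀ {u v} → Adj G u v → Adj G v u) (irrefl : ∀ {v} → ¬ Adj G v v) (tree : IsTree G)
    (third : (b c : V G) → ∃ λ (z : V G) → z ≢ b × z ≢ c) (root : V G) where
  open Finite fin

  rootings : ∀ r → Rooting G r
  rootings = BreadthFirst.rooting fin G-sym irrefl tree

  maximum = Duality.γt-packing fin noIso (rootings root)
  P       = proj₁ maximum
  packing = proj₁ (proj₂ maximum)
  γ       = proj₂ (proj₂ maximum)

  open Bumps fin noIso G-sym irrefl {P} γ

  SingleBump : V G → V G → Set
  SingleBump u v = Adj G u v × γtIncreases G (subdivide G [ u , v ])

  -- Both domination numbers are computable, so the case of value 1 can be split off constructively.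
  single-bump? : ∀ u v → Dec (SingleBump u v)
  single-bump? u v = adj? u v ×-dec increases?
    where
    γ′ = γt-exists (subdivide-finite fin [ u , v ]) (subdivide-noIso fin noIso [ u , v ])
    increases? : Dec (γtIncreases G (subdivide G [ u , v ]))
    increases? = map′ (λ lt → length P , proj₁ γ′ , γ , proj₂ γ′ , lt)
      (λ { (_ , _ , γ₁ , γ₂ , lt) → subst₂ _<_ (γt-unique γ₁ γ) (γt-unique γ₂ (proj₂ γ′)) lt })
      (length P ℕ.<? proj₁ γ′)

  empty-no-bump : ¬ γtIncreases G (subdivide G [])
  empty-no-bump = no-bump γ (subdivide-finite fin []) (map inj₁ D) dominated
    (≤-reflexive (trans (length-map inj₁ D) (proj₂ (proj₂ (proj₁ γ)))))
    where
    D = proj₁ (proj₁ γ)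
    dominated : ∀ v′ → ∃ λ u → u ∈ map inj₁ D × Adj (subdivide G []) v′ u
    dominated (inj₁ v) with proj₂ (proj₁ (proj₂ (proj₁ γ))) v
    ... | u , u∈D , vu = inj₁ u , ∈-map⁺ inj₁ u∈D , vu , λ ()

  -- The bound over all edges gives minimality of `k` both on the chosen edge and among the edges.
  equal-numbers : ∀ k → 1 ≤ k → ListBump k → EdgeBump k →
    (∀ F → IsEdgeSet G F → γtIncreases G (subdivide G F) → k ≤ length F) →
    (∀ {u v s} → Adj G u v → 1 ≤ s → γtIncreases G (subdivideEdge G u v s) → k ≤ s) →
    Σ ℕ λ k → IsSdγt G k × IsMsdγt G k
  equal-numbers k 1≤k list (u , v , uv , edge) list≥ edge≥ =
    k , (list , list≥) ,
    (u , v , uv , (1≤k , edge) , λ s → edge≥ uv) ,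
    λ u v t uv ((1≤t , bumps) , _) → edge≥ uv 1≤t bumps

  module _ (no-single : ∀ {u v} → Adj G u v → ¬ γtIncreases G (subdivide G [ u , v ])) where

    list≥2 : ∀ F → IsEdgeSet G F → γtIncreases G (subdivide G F) → 2 ≤ length F
    list≥2 [] _ bumps = ⊥-elim (empty-no-bump bumps)
    list≥2 (_ ∷ []) (uv ∷ [] , _) bumps = ⊥-elim (no-single uv bumps)
    list≥2 (_ ∷ _ ∷ _) _ _ = s≤s (s≤s z≤n)

    edge≥2 : ∀ {u v s} → Adj G u v → 1 ≤ s → γtIncreases G (subdivideEdge G u v s) → 2 ≤ s
    edge≥2 {s = suc zero} uv _ bumps = ⊥-elim (no-single uv (edge⇒single bumps))
    edge≥2 {s = suc (suc _)} _ _ _ = s≤s (s≤s z≤n)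

    module _ (perfect : Perfect G P) where

      antichain-no-bump : ∀ {F} → Antichain fin G-sym F → ¬ γtIncreases G (subdivide G F)
      antichain-no-bump {F} A =
        Shift.shift-no-bump fin G-sym perfect (directed-list fin G-sym A) γ (subdivide-finite fin F)

      list≥3 : ∀ F → IsEdgeSet G F → γtIncreases G (subdivide G F) → 3 ≤ length F
      list≥3 F@(_ ∷ _ ∷ []) (uv ∷ xy ∷ [] , (distinct ∷ []) ∷ _) bumps =
        ⊥-elim (antichain-no-bump (antichain-pair fin G-sym rootings uv xy distinct) bumps)
      list≥3 (_ ∷ _ ∷ _ ∷ _) _ _ = s≤s (s≤s (s≤s z≤n))
      list≥3 F@[] es bumps = ⊥-elim (<⇒≱ (s≤s z≤n) (list≥2 F es bumps))
      list≥3 F@(_ ∷ []) es bumps = ⊥-elim (<⇒≱ (s≤s (s≤s z≤n)) (list≥2 F es bumps))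

      edge≥3 : ∀ {u v s} → Adj G u v → 1 ≤ s → γtIncreases G (subdivideEdge G u v s) → 3 ≤ s
      edge≥3 {s = suc zero} uv 1≤s bumps = ⊥-elim (<⇒≱ (s≤s (s≤s z≤n)) (edge≥2 uv 1≤s bumps))
      edge≥3 {u} {v} {suc (suc zero)} uv _ bumps = ⊥-elim
        (Shift.shift-no-bump fin G-sym perfect (directed-edge fin G-sym (rootings v) uv) γ
          (subdivideEdge-finite fin u v 2) bumps)
      edge≥3 {s = suc (suc (suc _))} _ _ _ = s≤s (s≤s (s≤s z≤n))

      -- A third vertex lies outside the pair of `π root` and its partner, and a walk to it leaves
      -- `P`.
      outsider : ∃ λ a → a ∉ P
      outsider with third (π root) (π (π root))
        where open Perfect perfect
      ... | z , z≢b , z≢c = leave-pair perfect (proj₁ tree _ z) (Perfect.π∈P perfect root) z≢b z≢c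

  sd≡msd : Σ ℕ λ k → IsSdγt G k × IsMsdγt G k
  sd≡msd with findVertex fin (λ u → findVertex fin (single-bump? u))
  ... | yes (u , v , uv , bumps) = equal-numbers 1 ≤-refl
    ([ u , v ] , (uv ∷ [] , [] ∷ []) , refl , bumps) (u , v , uv , single⇒edge bumps)
    (λ { [] _ bumps → ⊥-elim (empty-no-bump bumps) ; (_ ∷ _) _ _ → s≤s z≤n })
    (λ _ 1≤s _ → 1≤s)
  ... | no none = classify (perfect-or-bumps packing no-single)
    where
    no-single : ∀ {u v} → Adj G u v → ¬ γtIncreases G (subdivide G [ u , v ])
    no-single uv bumps = none (_ , _ , uv , bumps)
    classify : Perfect G P ⊎ ListBump 2 × EdgeBump 2 → Σ ℕ λ k → IsSdγt G k × IsMsdγt G k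
    classify (inj₁ perfect) = equal-numbers 3 (s≤s z≤n)
      (perfect-list perfect (proj₂ (outsider no-single perfect))) (perfect-edge perfect root)
      (list≥3 no-single perfect) (edge≥3 no-single perfect)
    classify (inj₂ (list , edge)) = equal-numbers 2 (s≤s z≤n) list edge (list≥2 no-single) (edge≥2 no-single)

theorem8 : (n : ℕ) (A : Fin n → Fin n → Bool) → IsSimpleMatrix n A →
    IsTree (fromMatrix n A) → 3 ≤ n →
    Σ ℕ (λ k → IsSdγt (fromMatrix n A) k × IsMsdγt (fromMatrix n A) k)
theorem8 n A (symmetric , irreflexive) tree 3≤n =
  Tree.sd≡msd fin noIso (λ {u} {v} uv → trans (symmetric v u) uv) (irreflexive _) tree third
    (Fin.fromℕ< (≤-trans (s≤s z≤n) 3≤n))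
  where
  G = fromMatrix n A

  fin : Finite G
  fin = record
    { _≟_ = Fin._≟_ ; adj? = λ u v → A u v Bool.≟ true ; vertices = allFin n ; complete = ∈-allFin }

  third : ∀ b c → ∃ λ z → z ≢ b × z ≢ c
  third b c = decidable-stable (findVertex fin λ z → ¬? (z Fin.≟ b) ×-dec ¬? (z Fin.≟ c))
    -- Otherwise all `n` vertices would lie in a list of length two.
    λ none → <⇒≱ 3≤n (subst (_≤ 2) (length-tabulate {n = n} (λ i → i))
      (length≤-by-injection _≡_ (Unique.allFin⁺ n) (λ {z} _ → z , member none z , refl)
        λ { _ _ refl refl → refl }))
    where
    member : ¬ (∃ λ z → z ≢ b × z ≢ c) → ∀ z → z ∈ b ∷ c ∷ []
    member none z with z Fin.≟ b | z Fin.≟ c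
    ... | yes refl | _        = here refl
    ... | no _     | yes refl = there (here refl)
    ... | no z≢b   | no z≢c   = ⊥-elim (none (z , z≢b , z≢c))

  noIso : NoIsolated G
  noIso v with third v v
  ... | z , z≢v , _ with proj₁ tree v z
  ...   | here = ⊥-elim (z≢v refl)
  ...   | step vw _ = _ , vw
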